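{- Let $(G,\sigma)$ be a finite connected signed graph, $D$ the diameter and $\mathrm{vol}(G)=\sum_{x\in V}d_x$ the volume of $G$. Then for any $p>1$, the first (smallest) nonzero eigenvalue $\lambda_{p}^{\sigma}$ of the signed $p$-Laplacian $\Delta_p^{\sigma}$ satisfies \[ \lambda_{p}^{\sigma}\geq\frac{1}{(D+1)^{p-1}\mathrm{vol}(G)}. \]
   Context: $G=(V,E)$ is a finite simple connected graph with degrees $d_x$; $\sigma:E\to\{\pm1\}$, $\sigma_{xy}=\sigma(\{x,y\})$. For $p>1$, the signed $p$-Laplacian is $\Delta_{p}^{\sigma}f(x)=\frac{1}{d_{x}}\sum_{y\sim x}|\sigma_{xy}f(y)-f(x)|^{p-2}(\sigma_{xy}f(y)-f(x))$, with the convention $|t|^{p-2}t=0$ for $t=0$. A real $\lambda$ is an eigenvalue of $\Delta_p^\sigma$ if there is a nonzero $f:V\to\mathbb{R}$ with $-\Delta_{p}^{\sigma}f(x)=\lambda|f(x)|^{p-2}f(x)$ for all $x\in V$. -}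

module Defs where

open import Level using (Level; suc; 0ℓ)
open import Algebra.Bundles using (CommutativeRing; Semiring)
open import Axiom.ExcludedMiddle using (ExcludedMiddle)
open import Data.Bool.Base using (if_then_else_)
open import Data.Fin.Base using (Fin)
open import Data.Fin.Subset using (Subset; ∣_∣)
open import Data.Nat.Base as ℕ using (ℕ)
open import Data.Nat.Properties using (+-0-commutativeMonoid)
open import Data.Product.Base using (_×_; ∃; ∃₂; _,_; proj₁)
open import Data.Sign.Base as Sign using (Sign)
open import Data.Vec.Base using (tabulate)
open import Relation.Binary.Core using (Rel)
open import Relation.Binary.Definitions using (Symmetric; Irreflexive; Decidable)
open import Relation.Binary.PropositionalEquality.Core using (_≡_)
open import Relation.Binary.Structures using (IsTotalOrder)
open import Relation.Nullary using (¬_; Dec; yes; no; does)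
open import Relation.Unary using (Pred)

import Algebra.Definitions.RawMonoid as RawMonoidDefs
import Algebra.Definitions.RawSemiring as RawSemiringDefs
import Algebra.Properties.CommutativeMonoid.Sum as Sum

-- The axioms of the real numbers (unique up to isomorphism, classically).
record CompleteOrderedField (ℓ : Level) : Set (suc ℓ) where
  infix 4 _≤_ _<_
  field
    commutativeRing : CommutativeRing ℓ ℓ
  open CommutativeRing commutativeRing public
  field
    0≉1          : ¬ 0# ≈ 1#
    inverse      : ∀ x → ¬ x ≈ 0# → ∃ λ y → x * y ≈ 1#
    _≤_          : Rel Carrier ℓ
    isTotalOrder : IsTotalOrder _≈_ _≤_
    +-monoˡ-≤    : ∀ {x y} z → x ≤ y → x + z ≤ y + z
    *-nonNeg     : ∀ {x y} → 0# ≤ x → 0# ≤ y → 0# ≤ x * y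

  IsUpperBound : Pred Carrier ℓ → Carrier → Set ℓ
  IsUpperBound P u = ∀ x → P x → x ≤ u

  IsSupremum : Pred Carrier ℓ → Carrier → Set ℓ
  IsSupremum P s = IsUpperBound P s × (∀ u → IsUpperBound P u → s ≤ u)

  field
    complete : ∀ (P : Pred Carrier ℓ) → ∃ P → ∃ (IsUpperBound P) →
               ∃ (IsSupremum P)

  _<_ : Rel Carrier ℓ
  x < y = x ≤ y × ¬ x ≈ y

module RealOperations {ℓ} (em : ExcludedMiddle ℓ) (ℝ : CompleteOrderedField ℓ) where
  open CompleteOrderedField ℝ
  open RawMonoidDefs +-rawMonoid public using (sum) renaming (_×_ to _·_)
  open RawSemiringDefs (Semiring.rawSemiring semiring)
    using () renaming (_^_ to _^ℕ_)

  fromℕ : ℕ → Carrier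
  fromℕ n = n · 1#

  _≈?_ : Decidable _≈_
  x ≈? y = em

  _≤?_ : Decidable _≤_
  x ≤? y = em

  -- Convention: 0⁻¹ = 0.
  infix 9 _⁻¹
  _⁻¹ : Carrier → Carrier
  x ⁻¹ with x ≈? 0#
  ... | yes _   = 0#
  ... | no  x≉0 = proj₁ (inverse x x≉0)

  abs : Carrier → Carrier
  abs x = if does (0# ≤? x) then x else - x

  -- Convention: 0 for a set which is empty or unbounded above.
  sup : Pred Carrier ℓ → Carrier
  sup P with em {∃ P × ∃ (IsUpperBound P)}
  ... | yes (nonempty , bounded) = proj₁ (complete P nonempty bounded)
  ... | no  _                    = 0#

  -- For 1 ≤ b and 0 ≤ a: b ^ a is the supremum of the b ^ (m / n) over the
  -- rationals 0 ≤ m / n ≤ a, where n = k + 1 and t ≤ b ^ (m / n) is written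
  -- t ^ n ≤ b ^ m.
  BelowPower : Carrier → Carrier → Pred Carrier ℓ
  BelowPower b a t = ∃₂ λ (m k : ℕ) →
    fromℕ m ≤ fromℕ (ℕ.suc k) * a × 0# ≤ t × t ^ℕ ℕ.suc k ≤ b ^ℕ m

  -- Real powers of a base 0 < b, the remaining cases being reduced to the above
  -- by b ^ a = (b ^ (- a)) ⁻¹ = ((b ⁻¹) ^ a) ⁻¹ = (b ⁻¹) ^ (- a).  The value for
  -- b ≤ 0 is meaningless.
  infixr 8 _^_
  _^_ : Carrier → Carrier → Carrier
  b ^ a with 1# ≤? b | 0# ≤? a
  ... | yes _ | yes _ = sup (BelowPower b a)
  ... | yes _ | no  _ = (sup (BelowPower b (- a))) ⁻¹
  ... | no  _ | yes _ = (sup (BelowPower (b ⁻¹) a)) ⁻¹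
  ... | no  _ | no  _ = sup (BelowPower (b ⁻¹) (- a))

  -- |t|^(p-2) t, read as 0 at t = 0.
  φ : Carrier → Carrier → Carrier
  φ p t = if does (t ≈? 0#) then 0# else abs t ^ (p - (1# + 1#)) * t

  ⟦_⟧ : Sign → Carrier
  ⟦ Sign.+ ⟧ = 1#
  ⟦ Sign.- ⟧ = - 1#

-- A finite simple graph on n vertices together with signs on its edges; the
-- values of σ at non-adjacent pairs are irrelevant.
record SignedGraph (n : ℕ) : Set₁ where
  infix 4 _~_ _~?_
  field
    _~_      : Rel (Fin n) 0ℓ
    _~?_     : Decidable _~_
    ~-sym    : Symmetric _~_
    ~-irrefl : Irreflexive _≡_ _~_
    σ        : Fin n → Fin n → Sign
    σ-sym    : ∀ {x y} → x ~ y → σ x y ≡ σ y x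

  neighbours : Fin n → Subset n
  neighbours x = tabulate λ y → does (x ~? y)

  degree : Fin n → ℕ
  degree x = ∣ neighbours x ∣

  vol : ℕ
  vol = Sum.sum +-0-commutativeMonoid degree

  data Walk : ℕ → Fin n → Fin n → Set where
    []  : ∀ {x} → Walk 0 x x
    _∷_ : ∀ {k x y z} → x ~ y → Walk k y z → Walk (ℕ.suc k) x z

  Connected : Set
  Connected = ∀ x y → ∃ λ k → Walk k x y

  IsDistance : Fin n → Fin n → ℕ → Set
  IsDistance x y k = Walk k x y × (∀ j → Walk j x y → k ℕ.≤ j)

  IsDiameter : ℕ → Set
  IsDiameter D = (∃₂ λ x y → IsDistance x y D) ×
                 (∀ x y k → IsDistance x y k → k ℕ.≤ D)

module PLaplacian {ℓ} (em : ExcludedMiddle ℓ) (ℝ : CompleteOrderedField ℓ)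
                  {n} (G : SignedGraph n) where
  open CompleteOrderedField ℝ
  open RealOperations em ℝ
  open SignedGraph G

  Δ : Carrier → (Fin n → Carrier) → Fin n → Carrier
  Δ p f x = fromℕ (degree x) ⁻¹ *
    sum λ y → if does (x ~? y) then φ p (⟦ σ x y ⟧ * f y - f x) else 0#

  IsEigenvalue : Carrier → Carrier → Set ℓ
  IsEigenvalue p μ = ∃ λ (f : Fin n → Carrier) →
    ¬ (∀ x → f x ≈ 0#) × (∀ x → - Δ p f x ≈ μ * φ p (f x))

  IsFirstNonzeroEigenvalue : Carrier → Carrier → Set ℓ
  IsFirstNonzeroEigenvalue p μ =
    (IsEigenvalue p μ × ¬ μ ≈ 0#) ×
    (∀ ν → IsEigenvalue p ν → ¬ ν ≈ 0# → μ ≤ ν)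

-- Let M = |f x₀| be the maximum of |f| for an eigenfunction f with eigenvalue
-- λ ≠ 0, and let δ = M / (D + 1).  Pair the eigenvalue equation, weighted by the
-- degrees, with H t ∘ f, where H t u is the sign of u if |u| ≥ t and 0 otherwise.
-- Each edge then contributes (H t u - H t v) φ(u - v) ≥ 0, with u = f x and
-- v = σ f y, while the vertex side is at most λ vol φ(M).  If some edge has
-- |u - v| ≥ δ, then t can be chosen with |H t u - H t v| ≥ 1, and φ(δ) ≤ λ vol φ(M)
-- with φ(M) = (D + 1)^(p - 1) φ(δ) is the bound.  Otherwise a walk of length at
-- most D from x₀ shows |f| ≥ δ everywhere; then H δ u = H δ v on every edge, so
-- all edges contribute 0 although the vertex side does not vanish.

module Submission where

open import Defs
open import Axiom.ExcludedMiddle using (ExcludedMiddle)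
open import Axiom.DoubleNegationElimination using (em⇒dne)
open import Data.Nat.Base using (ℕ; suc)
open import Algebra.Bundles using (CommutativeRing)
open import Algebra.Solver.Ring.AlmostCommutativeRing
  using (Induced-equivalence; _-Raw-AlmostCommutative⟶_; fromCommutativeRing)
import Algebra.Properties.AbelianGroup as AbelianGroupProperties
import Algebra.Properties.CommutativeMonoid.Sum as MonoidSum
import Algebra.Properties.CommutativeSemiring.Exp as Exp
import Algebra.Properties.Ring as RingProperties
import Algebra.Properties.Semiring.Mult as Mult
import Algebra.Properties.Semiring.Mult.TCOptimised as MultTC
import Algebra.Properties.Semiring.Sum as SemiringSum
import Algebra.Solver.Ring as RingSolver
open import Data.Bool.Base using (if_then_else_)
open import Data.Empty using (⊥-elim)
open import Data.Fin.Base as Fin using (Fin)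
import Data.Fin.Properties as Fin
open import Data.Fin.Subset as Subset using (∣_∣)
open import Data.Fin.Subset.Properties using (x∈p⇒∣p-x∣<∣p∣)
open import Data.Integer.Base as ℤ using (ℤ; +_; -[1+_])
import Data.Integer.Properties as ℤ
import Data.Maybe.Base as Maybe
import Data.Nat.Base as ℕ
open import Data.Nat.Induction using (Acc; acc; <-wellFounded)
import Data.Nat.Properties as ℕ
open import Data.Product.Base using (_×_; _,_; ∃; ∃₂; proj₁; proj₂)
open import Data.Sign.Base as Sign using (Sign)
open import Data.Sum.Base using (_⊎_; inj₁; inj₂; [_,_]′)
open import Data.Vec.Properties using (lookup⇒[]=; lookup∘tabulate)
open import Function.Base using (_∘_)
open import Level using (Lift; lift)
open import Relation.Binary.Bundles using (Poset)
open import Relation.Binary.Definitions using (WeaklyDecidable)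
open import Relation.Binary.PropositionalEquality.Core as ≡ using (_≡_)
open import Relation.Binary.Structures using (IsTotalOrder)
import Relation.Binary.Construct.NonStrictToStrict as ToStrict
import Relation.Binary.Reasoning.PartialOrder as PosetReasoning
open import Relation.Nullary using (¬_; Dec; yes; no; does; contradiction)
open import Relation.Nullary.Decidable using (dec⇒maybe; dec-true)

-- Pairing the equation with `f` itself, as for a Rayleigh quotient, bounds a steep edge below by
-- δ^p and the vertex side above by λ vol M^p. That yields only the exponent p in place of p - 1,
-- and repairing it would take Hölder's inequality along a walk. A test function bounded by 1 adds
-- no power of `f` on either side, and only monotonicity, oddness and homogeneity of φ enter. In the
-- flat case τ = H δ ∘ f has values ±1 and satisfies τ x = σ τ y on every edge: it is a switching
-- function, so the signed graph is balanced. The pairing becomes the orthogonality relation Σ d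
-- φ(f) τ = 0 of eigenfunctions with nonzero eigenvalue, yet its terms are nonnegative and not all
-- zero, since τ carries the signs of `f`. The other obstacle is `_^_`: it is given by suprema and
-- by cases, and the exponent p - 2 may be negative. Its laws are derived from the growth of integer
-- powers, known only up to a constant factor.

-- Ring identities with integer coefficients

module IntegerCoefficients {c ℓ} (R : CommutativeRing c ℓ) where
  open CommutativeRing R
  open RingProperties ring
    using (-0#≈0#; -‿involutive; -1*x≈-x)
  open AbelianGroupProperties +-abelianGroup using (⁻¹-∙-comm)
  open MultTC semiring using (×-homo-+; ×1-homo-*) renaming (_×_ to _·_)
  open import Relation.Binary.Reasoning.Setoid setoid

  -- The optimised multiple makes `1 · 1#` reduce to `1#`, so the solver constant `:1` denotes `1#`
  -- itself and not `1# + 0#`.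
  fromℤ : ℤ → Carrier
  fromℤ (+ n)    = n · 1#
  fromℤ -[1+ n ] = - (suc n · 1#)

  private
    shuffle : ∀ x y z w → (x + y) - (z + w) ≈ (x - z) + (y - w)
    shuffle x y z w = begin
      (x + y) - (z + w)       ≈⟨ +-congˡ (⁻¹-∙-comm z w) ⟨
      (x + y) + (- z + - w)   ≈⟨ +-assoc x y _ ⟩
      x + (y + (- z + - w))   ≈⟨ +-congˡ (+-assoc y (- z) (- w)) ⟨
      x + ((y + - z) + - w)   ≈⟨ +-congˡ (+-congʳ (+-comm y (- z))) ⟩
      x + ((- z + y) + - w)   ≈⟨ +-congˡ (+-assoc (- z) y (- w)) ⟩
      x + (- z + (y - w))     ≈⟨ +-assoc x (- z) _ ⟨
      (x - z) + (y - w)       ∎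

    suc-· : ∀ n → suc n · 1# ≈ 1# + n · 1#
    suc-· n = ×-homo-+ 1# 1 n

  fromℤ-neg : ∀ i → fromℤ (ℤ.- i) ≈ - fromℤ i
  fromℤ-neg (+ 0)     = sym -0#≈0#
  fromℤ-neg (+ suc n) = refl
  fromℤ-neg -[1+ n ]  = sym (-‿involutive _)

  fromℤ-⊖ : ∀ m n → fromℤ (m ℤ.⊖ n) ≈ m · 1# - n · 1#
  fromℤ-⊖ m 0 = begin
    m · 1#          ≈⟨ +-identityʳ _ ⟨
    m · 1# + 0#     ≈⟨ +-congˡ -0#≈0# ⟨
    m · 1# - 0#     ∎
  fromℤ-⊖ 0 (suc n) = sym (+-identityˡ _)
  fromℤ-⊖ (suc m) (suc n) = begin
    fromℤ (suc m ℤ.⊖ suc n)          ≡⟨ ≡.cong fromℤ (ℤ.[1+m]⊖[1+n]≡m⊖n m n) ⟩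
    fromℤ (m ℤ.⊖ n)                  ≈⟨ fromℤ-⊖ m n ⟩
    m · 1# - n · 1#                  ≈⟨ +-identityˡ _ ⟨
    0# + (m · 1# - n · 1#)           ≈⟨ +-congʳ (-‿inverseʳ 1#) ⟨
    (1# - 1#) + (m · 1# - n · 1#)    ≈⟨ shuffle _ _ _ _ ⟨
    (1# + m · 1#) - (1# + n · 1#)    ≈⟨ +-cong (suc-· m) (-‿cong (suc-· n)) ⟨
    suc m · 1# - suc n · 1#          ∎

  fromℤ-+ : ∀ i j → fromℤ (i ℤ.+ j) ≈ fromℤ i + fromℤ j
  fromℤ-+ (+ m)    (+ n)    = ×-homo-+ 1# m n
  fromℤ-+ (+ m)    -[1+ n ] = fromℤ-⊖ m (suc n)
  fromℤ-+ -[1+ m ] (+ n)    = trans (fromℤ-⊖ n (suc m)) (+-comm _ _)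
  fromℤ-+ -[1+ m ] -[1+ n ] = begin
    - (suc (suc (m ℕ.+ n)) · 1#)        ≡⟨ ≡.cong (λ k → - (k · 1#)) (ℕ.+-suc (suc m) n) ⟨
    - ((suc m ℕ.+ suc n) · 1#)          ≈⟨ -‿cong (×-homo-+ 1# (suc m) (suc n)) ⟩
    - (suc m · 1# + suc n · 1#)         ≈⟨ ⁻¹-∙-comm _ _ ⟨
    - (suc m · 1#) + - (suc n · 1#)     ∎

  private
    fromSign : Sign → Carrier
    fromSign Sign.+ = 1#
    fromSign Sign.- = - 1#

    fromSign-* : ∀ s t → fromSign (s Sign.* t) ≈ fromSign s * fromSign t
    fromSign-* Sign.+ t      = sym (*-identityˡ _)
    fromSign-* Sign.- Sign.+ = sym (*-identityʳ _)
    fromSign-* Sign.- Sign.- = sym (trans (-1*x≈-x _) (-‿involutive _))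

    fromℤ-◃ : ∀ s n → fromℤ (s ℤ.◃ n) ≈ fromSign s * (n · 1#)
    fromℤ-◃ s      0       = sym (zeroʳ _)
    fromℤ-◃ Sign.+ (suc n) = sym (*-identityˡ _)
    fromℤ-◃ Sign.- (suc n) = sym (-1*x≈-x _)

    fromℤ-sign-abs : ∀ i → fromℤ i ≈ fromSign (ℤ.sign i) * (ℤ.∣ i ∣ · 1#)
    fromℤ-sign-abs (+ n)    = sym (*-identityˡ _)
    fromℤ-sign-abs -[1+ n ] = sym (-1*x≈-x _)

    interchange : ∀ x y z w → (x * y) * (z * w) ≈ (x * z) * (y * w)
    interchange x y z w = begin
      (x * y) * (z * w)   ≈⟨ *-assoc x y _ ⟩
      x * (y * (z * w))   ≈⟨ *-congˡ (*-assoc y z w) ⟨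
      x * ((y * z) * w)   ≈⟨ *-congˡ (*-congʳ (*-comm y z)) ⟩
      x * ((z * y) * w)   ≈⟨ *-congˡ (*-assoc z y w) ⟩
      x * (z * (y * w))   ≈⟨ *-assoc x z _ ⟨
      (x * z) * (y * w)   ∎

  fromℤ-* : ∀ i j → fromℤ (i ℤ.* j) ≈ fromℤ i * fromℤ j
  fromℤ-* i j = begin
    fromℤ (i ℤ.* j)
      ≈⟨ fromℤ-◃ (ℤ.sign i Sign.* ℤ.sign j) (ℤ.∣ i ∣ ℕ.* ℤ.∣ j ∣) ⟩
    fromSign (ℤ.sign i Sign.* ℤ.sign j) * ((ℤ.∣ i ∣ ℕ.* ℤ.∣ j ∣) · 1#)
      ≈⟨ *-cong (fromSign-* (ℤ.sign i) (ℤ.sign j)) (×1-homo-* ℤ.∣ i ∣ ℤ.∣ j ∣) ⟩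
    (fromSign (ℤ.sign i) * fromSign (ℤ.sign j)) * ((ℤ.∣ i ∣ · 1#) * (ℤ.∣ j ∣ · 1#))
      ≈⟨ interchange _ _ _ _ ⟩
    (fromSign (ℤ.sign i) * (ℤ.∣ i ∣ · 1#)) * (fromSign (ℤ.sign j) * (ℤ.∣ j ∣ · 1#))
      ≈⟨ *-cong (fromℤ-sign-abs i) (fromℤ-sign-abs j) ⟨
    fromℤ i * fromℤ j ∎

  morphism : ℤ.+-*-rawRing -Raw-AlmostCommutative⟶ fromCommutativeRing R
  morphism = record
    { ⟦_⟧    = fromℤ
    ; +-homo = fromℤ-+
    ; *-homo = fromℤ-*
    ; -‿homo = fromℤ-neg
    ; 0-homo = refl
    ; 1-homo = refl
    }

  -- Equality of carrier elements is decided only by `em`, which does not compute; comparing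
  -- coefficients as integers lets normal forms be found by evaluation.
  fromℤ-≟ : WeaklyDecidable (Induced-equivalence morphism)
  fromℤ-≟ i j = Maybe.map (λ i≡j → reflexive (≡.cong fromℤ i≡j)) (dec⇒maybe (i ℤ.≟ j))

  open RingSolver ℤ.+-*-rawRing (fromCommutativeRing R) morphism
    fromℤ-≟
    public using (Polynomial; solve; con; _:+_; _:*_; _:-_; :-_; _:=_)

  :0 :1 : ∀ {n} → Polynomial n
  :0 = con (+ 0)
  :1 = con (+ 1)

-- Order and arithmetic in a complete ordered field

module OrderedField {ℓ} (em : ExcludedMiddle ℓ) (ℝ : CompleteOrderedField ℓ) where
  open CompleteOrderedField ℝ
  open RealOperations em ℝ
  open IntegerCoefficients commutativeRing
    using (solve; :0; :1; _:+_; _:*_; _:-_; :-_; _:=_)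
  open Exp commutativeSemiring using (^-distrib-*; ^-congˡ)
    renaming (_^_ to _^ℕ_)
  open IsTotalOrder isTotalOrder
    using (antisym; total; isPartialOrder)
    renaming (trans to ≤-trans; refl to ≤-refl; reflexive to ≤-reflexive)

  poset : Poset ℓ ℓ ℓ
  poset = record { isPartialOrder = isPartialOrder }

  open PosetReasoning poset

  2# : Carrier
  2# = 1# + 1#

  ≤-difference : ∀ {x y d} → 0# ≤ d → y ≈ x + d → x ≤ y
  ≤-difference {x} {y} {d} 0≤d y≈x+d = begin
    x       ≈⟨ +-identityˡ x ⟨
    0# + x  ≤⟨ +-monoˡ-≤ x 0≤d ⟩
    d + x   ≈⟨ +-comm d x ⟩
    x + d   ≈⟨ y≈x+d ⟨
    y       ∎

  +-mono-≤ : ∀ {x y u v} → x ≤ y → u ≤ v → x + u ≤ y + v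
  +-mono-≤ {x} {y} {u} {v} x≤y u≤v = begin
    x + u  ≤⟨ +-monoˡ-≤ u x≤y ⟩
    y + u  ≈⟨ +-comm y u ⟩
    u + y  ≤⟨ +-monoˡ-≤ y u≤v ⟩
    v + y  ≈⟨ +-comm v y ⟩
    y + v  ∎

  x≤y⇒0≤y-x : ∀ {x y} → x ≤ y → 0# ≤ y - x
  x≤y⇒0≤y-x {x} {y} x≤y = begin
    0#     ≈⟨ -‿inverseʳ x ⟨
    x - x  ≤⟨ +-monoˡ-≤ (- x) x≤y ⟩
    y - x  ∎

  +-cancelʳ-≤ : ∀ {x y} z → x + z ≤ y + z → x ≤ y
  +-cancelʳ-≤ {x} {y} z h = ≤-difference (x≤y⇒0≤y-x h)
    (solve 3 (λ x y z → y := x :+ ((y :+ z) :- (x :+ z))) refl x y z)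

  -‿anti-≤ : ∀ {x y} → x ≤ y → - y ≤ - x
  -‿anti-≤ {x} {y} x≤y = ≤-difference (x≤y⇒0≤y-x x≤y)
    (solve 2 (λ x y → :- x := :- y :+ (y :- x)) refl x y)

  +-nonNeg : ∀ {x y} → 0# ≤ x → 0# ≤ y → 0# ≤ x + y
  +-nonNeg 0≤x 0≤y = ≤-trans (≤-reflexive (sym (+-identityʳ 0#))) (+-mono-≤ 0≤x 0≤y)

  x≤x+y : ∀ {x y} → 0# ≤ y → x ≤ x + y
  x≤x+y 0≤y = ≤-difference 0≤y refl

  ≰⇒> : ∀ {x y} → ¬ x ≤ y → y < x
  ≰⇒> = ToStrict.≰⇒> _≈_ _≤_ sym ≤-reflexive total

  <⇒≱ : ∀ {x y} → x < y → ¬ y ≤ x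
  <⇒≱ = ToStrict.<⇒≱ _≈_ _≤_ antisym

  ≤∨> : ∀ x y → x ≤ y ⊎ y < x
  ≤∨> x y with x ≤? y
  ... | yes x≤y = inj₁ x≤y
  ... | no  x≰y = inj₂ (≰⇒> x≰y)

  <-trichotomy-0 : ∀ x → 0# < x ⊎ x ≈ 0# ⊎ x < 0#
  <-trichotomy-0 x with ≤∨> x 0# | x ≈? 0#
  ... | inj₂ 0<x | _       = inj₁ 0<x
  ... | inj₁ _   | yes x≈0 = inj₂ (inj₁ x≈0)
  ... | inj₁ x≤0 | no  x≉0 = inj₂ (inj₂ (x≤0 , x≉0))

  x<0⇒0<-x : ∀ {x} → x < 0# → 0# < - x
  x<0⇒0<-x {x} (x≤0 , x≉0) =
      ≤-difference (x≤y⇒0≤y-x x≤0) (solve 1 (λ x → :- x := :0 :+ (:0 :- x)) refl x)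
    , λ 0≈-x → x≉0 (trans (solve 1 (λ x → x := :- :- x) refl x)
                          (trans (-‿cong (sym 0≈-x)) (solve 0 (:- :0 := :0) refl)))

  *-monoʳ-≤ : ∀ {x y z} → 0# ≤ z → x ≤ y → z * x ≤ z * y
  *-monoʳ-≤ {x} {y} {z} 0≤z x≤y = ≤-difference (*-nonNeg 0≤z (x≤y⇒0≤y-x x≤y))
    (solve 3 (λ x y z → z :* y := z :* x :+ z :* (y :- x)) refl x y z)

  *-monoˡ-≤ : ∀ {x y z} → 0# ≤ z → x ≤ y → x * z ≤ y * z
  *-monoˡ-≤ {x} {y} {z} 0≤z x≤y = begin
    x * z  ≈⟨ *-comm x z ⟩
    z * x  ≤⟨ *-monoʳ-≤ 0≤z x≤y ⟩
    z * y  ≈⟨ *-comm z y ⟩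
    y * z  ∎

  *-mono-≤ : ∀ {x y u v} → 0# ≤ x → x ≤ y → 0# ≤ u → u ≤ v → x * u ≤ y * v
  *-mono-≤ 0≤x x≤y 0≤u u≤v =
    ≤-trans (*-monoˡ-≤ 0≤u x≤y) (*-monoʳ-≤ (≤-trans 0≤x x≤y) u≤v)

  0≤1 : 0# ≤ 1#
  0≤1 with total 0# 1#
  ... | inj₁ 0≤1 = 0≤1
  ... | inj₂ 1≤0 = ≤-trans (*-nonNeg 0≤-1 0≤-1)
                     (≤-reflexive (solve 0 (:- :1 :* :- :1 := :1) refl))
    where
    0≤-1 : 0# ≤ - 1#
    0≤-1 = ≤-trans (x≤y⇒0≤y-x 1≤0) (≤-reflexive (+-identityˡ _))

  0<1 : 0# < 1#
  0<1 = 0≤1 , 0≉1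

  0<-≤-trans : ∀ {x y} → 0# < x → x ≤ y → 0# < y
  0<-≤-trans {x} {y} 0<x x≤y = begin-strict 0# <⟨ 0<x ⟩ x ≤⟨ x≤y ⟩ y ∎

  <⇒≉0 : ∀ {x} → 0# < x → ¬ x ≈ 0#
  <⇒≉0 0<x x≈0 = proj₂ 0<x (sym x≈0)

  *-cancelʳ-≈0 : ∀ {x y} → ¬ y ≈ 0# → x * y ≈ 0# → x ≈ 0#
  *-cancelʳ-≈0 {x} {y} y≉0 xy≈0 with inverse y y≉0
  ... | y⁻¹ , yy⁻¹≈1 = begin-equality
    x                ≈⟨ *-identityʳ x ⟨
    x * 1#           ≈⟨ *-congˡ yy⁻¹≈1 ⟨
    x * (y * y⁻¹)    ≈⟨ *-assoc x y y⁻¹ ⟨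
    (x * y) * y⁻¹    ≈⟨ *-congʳ xy≈0 ⟩
    0# * y⁻¹         ≈⟨ zeroˡ y⁻¹ ⟩
    0#               ∎

  *-pos : ∀ {x y} → 0# < x → 0# < y → 0# < x * y
  *-pos 0<x 0<y = *-nonNeg (proj₁ 0<x) (proj₁ 0<y)
                , λ 0≈xy → <⇒≉0 0<x (*-cancelʳ-≈0 (<⇒≉0 0<y) (sym 0≈xy))

  *-cancelʳ-≤ : ∀ {x y z} → 0# < z → x * z ≤ y * z → x ≤ y
  *-cancelʳ-≤ {x} {y} {z} 0<z xz≤yz with ≤∨> x y
  ... | inj₁ x≤y = x≤y
  ... | inj₂ y<x = contradiction (*-cancelʳ-≈0 (<⇒≉0 0<z) x-y≈0)
        λ x-y≈0 → proj₂ y<x (sym (trans (solve 2 (λ x y → x := y :+ (x :- y)) refl x y)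
                                         (trans (+-congˡ x-y≈0) (+-identityʳ y))))
    where
    x-y≈0 : (x - y) * z ≈ 0#
    x-y≈0 = begin-equality
      (x - y) * z    ≈⟨ solve 3 (λ x y z → (x :- y) :* z := x :* z :- y :* z) refl x y z ⟩
      x * z - y * z  ≈⟨ +-congʳ (antisym xz≤yz (*-monoˡ-≤ (proj₁ 0<z) (proj₁ y<x))) ⟩
      y * z - y * z  ≈⟨ -‿inverseʳ _ ⟩
      0#             ∎

  *-cancelʳ : ∀ {x y z} → 0# < z → x * z ≈ y * z → x ≈ y
  *-cancelʳ 0<z e = antisym (*-cancelʳ-≤ 0<z (≤-reflexive e)) (*-cancelʳ-≤ 0<z (≤-reflexive (sym e)))

  positive-inverse : ∀ {x} → 0# < x → ∃ λ y → 0# < y × x * y ≈ 1#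
  positive-inverse {x} 0<x with inverse x (<⇒≉0 0<x)
  ... | y , xy≈1 = y , ≰⇒> y≰0 , xy≈1
    where
    y≰0 : ¬ y ≤ 0#
    y≰0 y≤0 = <⇒≱ 0<1 (begin
      1#      ≈⟨ xy≈1 ⟨
      x * y   ≤⟨ *-monoʳ-≤ (proj₁ 0<x) y≤0 ⟩
      x * 0#  ≈⟨ zeroʳ x ⟩
      0#      ∎)

  ⁻¹-inverseʳ : ∀ {x} → ¬ x ≈ 0# → x * x ⁻¹ ≈ 1#
  ⁻¹-inverseʳ {x} x≉0 with x ≈? 0#
  ... | yes x≈0  = contradiction x≈0 x≉0
  ... | no  x≉0′ = proj₂ (inverse x x≉0′)

  ⁻¹-pos : ∀ {x} → 0# < x → 0# < x ⁻¹
  ⁻¹-pos {x} 0<x with positive-inverse 0<x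
  ... | y , 0<y , xy≈1 = 0<-≤-trans 0<y (≤-reflexive (*-cancelʳ 0<x (begin-equality
    y * x       ≈⟨ *-comm y x ⟩
    x * y       ≈⟨ xy≈1 ⟩
    1#          ≈⟨ ⁻¹-inverseʳ (<⇒≉0 0<x) ⟨
    x * x ⁻¹    ≈⟨ *-comm x _ ⟩
    x ⁻¹ * x    ∎)))

  -- `y ≤ 0` would force `x * y ≤ 0`, so the positivity of `y` comes as a by-product. In the final
  -- bound this covers the product containing `vol`.
  1≤x*y⇒y⁻¹≤x : ∀ {x y} → 0# ≤ x → 1# ≤ x * y → y ⁻¹ ≤ x
  1≤x*y⇒y⁻¹≤x {x} {y} 0≤x 1≤xy with ≤∨> y 0#
  ... | inj₁ y≤0 = contradiction 1≤xy (<⇒≱ (begin-strict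
    x * y    ≤⟨ *-monoʳ-≤ 0≤x y≤0 ⟩
    x * 0#   ≈⟨ zeroʳ x ⟩
    0#       <⟨ 0<1 ⟩
    1#       ∎))
  ... | inj₂ 0<y = *-cancelʳ-≤ 0<y (begin
    y ⁻¹ * y   ≈⟨ *-comm _ y ⟩
    y * y ⁻¹   ≈⟨ ⁻¹-inverseʳ (<⇒≉0 0<y) ⟩
    1#         ≤⟨ 1≤xy ⟩
    x * y      ∎)

  -- Natural numbers and the Archimedean property

  0≤fromℕ : ∀ n → 0# ≤ fromℕ n
  0≤fromℕ ℕ.zero  = ≤-refl
  0≤fromℕ (suc n) = +-nonNeg 0≤1 (0≤fromℕ n)

  1≤fromℕ-suc : ∀ n → 1# ≤ fromℕ (suc n)
  1≤fromℕ-suc n = x≤x+y (0≤fromℕ n)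

  0<fromℕ-suc : ∀ n → 0# < fromℕ (suc n)
  0<fromℕ-suc n = 0<-≤-trans 0<1 (1≤fromℕ-suc n)

  fromℕ-mono-≤ : ∀ {m n} → m ℕ.≤ n → fromℕ m ≤ fromℕ n
  fromℕ-mono-≤ {n = n} ℕ.z≤n = 0≤fromℕ n
  fromℕ-mono-≤ (ℕ.s≤s m≤n)   = +-mono-≤ ≤-refl (fromℕ-mono-≤ m≤n)

  x<1+x : ∀ x → x < 1# + x
  x<1+x x = ≤-difference 0≤1 (+-comm 1# x) , λ x≈1+x → 0≉1 (begin-equality
    0#          ≈⟨ -‿inverseʳ x ⟨
    x - x       ≈⟨ +-congʳ x≈1+x ⟩
    1# + x - x  ≈⟨ solve 1 (λ x → (:1 :+ x) :- x := :1) refl x ⟩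
    1#          ∎)

  fromℕ-cancel-≤ : ∀ m n → fromℕ m ≤ fromℕ n → m ℕ.≤ n
  fromℕ-cancel-≤ m n h with m ℕ.≤? n
  ... | yes m≤n = m≤n
  ... | no  m≰n = contradiction (≤-trans (fromℕ-mono-≤ (ℕ.≰⇒> m≰n)) h) (<⇒≱ (x<1+x (fromℕ n)))

  -- If `x` bounded all naturals, they would have a supremum `s`; as `n + 1 ≤ s` for every `n`,
  -- already `s - 1` would be an upper bound.
  archimedes : ∀ x → ∃ λ n → x ≤ fromℕ n
  archimedes x with em {∃ λ n → x ≤ fromℕ n}
  ... | yes exists = exists
  ... | no  none   with complete IsNatural (0# , 0 , refl) (x , x-bound)
    where
    IsNatural : Carrier → Set ℓ
    IsNatural t = ∃ λ n → t ≈ fromℕ n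
    x-bound : IsUpperBound IsNatural x
    x-bound t (n , t≈n) = ≤-trans (≤-reflexive t≈n) (proj₁ (≰⇒> λ x≤n → none (n , x≤n)))
  ...   | s , s-bound , s-least = ⊥-elim (<⇒≱ (x<1+x s) (begin
    1# + s            ≤⟨ +-mono-≤ ≤-refl (s-least (s - 1#) λ t (n , t≈n) → +-cancelʳ-≤ 1# (begin
      t + 1#            ≈⟨ +-comm t 1# ⟩
      1# + t            ≈⟨ +-congˡ t≈n ⟩
      fromℕ (suc n)     ≤⟨ s-bound _ (suc n , refl) ⟩
      s                 ≈⟨ solve 1 (λ s → s := s :- :1 :+ :1) refl s ⟩
      s - 1# + 1#       ∎)) ⟩
    1# + (s - 1#)     ≈⟨ solve 1 (λ s → :1 :+ (s :- :1) := s) refl s ⟩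
    s                 ∎))

  -- Both inequalities are weak, so two values qualify when `x` is a positive integer; the constants
  -- in `IsPower` absorb this ambiguity.
  floor : ∀ {x} → 0# ≤ x → ∃ λ m → fromℕ m ≤ x × x ≤ fromℕ (suc m)
  floor {x} 0≤x = search (proj₁ (archimedes x)) (proj₂ (archimedes x))
    where
    search : ∀ n → x ≤ fromℕ n → ∃ λ m → fromℕ m ≤ x × x ≤ fromℕ (suc m)
    search ℕ.zero  x≤0   = 0 , 0≤x , ≤-trans x≤0 (0≤fromℕ 1)
    search (suc n) x≤1+n with total x (fromℕ n)
    ... | inj₁ x≤n = search n x≤n
    ... | inj₂ n≤x = n , n≤x , x≤1+n

  archimedes-* : ∀ x {d} → 0# < d → ∃ λ n → x ≤ fromℕ n * d
  archimedes-* x {d} 0<d with positive-inverse 0<d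
  ... | e , 0<e , de≈1 with archimedes (x * e)
  ...   | n , xe≤n = n , (begin
    x              ≈⟨ *-identityʳ x ⟨
    x * 1#         ≈⟨ *-congˡ de≈1 ⟨
    x * (d * e)    ≈⟨ solve 3 (λ x d e → x :* (d :* e) := x :* e :* d) refl x d e ⟩
    x * e * d      ≤⟨ *-monoˡ-≤ (proj₁ 0<d) xe≤n ⟩
    fromℕ n * d    ∎)

  -- Integer powers and Bernoulli's inequality

  ^ℕ-pos : ∀ {x} n → 0# < x → 0# < x ^ℕ n
  ^ℕ-pos ℕ.zero  0<x = 0<1
  ^ℕ-pos (suc n) 0<x = *-pos 0<x (^ℕ-pos n 0<x)

  ^ℕ-nonNeg : ∀ {x} n → 0# ≤ x → 0# ≤ x ^ℕ n
  ^ℕ-nonNeg ℕ.zero  0≤x = 0≤1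
  ^ℕ-nonNeg (suc n) 0≤x = *-nonNeg 0≤x (^ℕ-nonNeg n 0≤x)

  ^ℕ-monoˡ-≤ : ∀ {x y} n → 0# ≤ x → x ≤ y → x ^ℕ n ≤ y ^ℕ n
  ^ℕ-monoˡ-≤ ℕ.zero  0≤x x≤y = ≤-refl
  ^ℕ-monoˡ-≤ (suc n) 0≤x x≤y = *-mono-≤ 0≤x x≤y (^ℕ-nonNeg n 0≤x) (^ℕ-monoˡ-≤ n 0≤x x≤y)

  1≤^ℕ : ∀ {b} n → 1# ≤ b → 1# ≤ b ^ℕ n
  1≤^ℕ ℕ.zero  1≤b = ≤-refl
  1≤^ℕ (suc n) 1≤b = ≤-trans (≤-reflexive (sym (*-identityʳ 1#))) (*-mono-≤ 0≤1 1≤b 0≤1 (1≤^ℕ n 1≤b))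

  ^ℕ-monoʳ-≤ : ∀ {b m n} → 1# ≤ b → m ℕ.≤ n → b ^ℕ m ≤ b ^ℕ n
  ^ℕ-monoʳ-≤ {n = n} 1≤b ℕ.z≤n = 1≤^ℕ n 1≤b
  ^ℕ-monoʳ-≤ 1≤b (ℕ.s≤s m≤n)   = *-monoʳ-≤ (≤-trans 0≤1 1≤b) (^ℕ-monoʳ-≤ 1≤b m≤n)

  ^ℕ-cancelˡ-≤ : ∀ {x y} k → 0# ≤ x → 0# ≤ y → x ^ℕ suc k ≤ y ^ℕ suc k → x ≤ y
  ^ℕ-cancelˡ-≤ {x} {y} k 0≤x 0≤y h with ≤∨> x y
  ... | inj₁ x≤y = x≤y
  ... | inj₂ y<x = *-cancelʳ-≤ (^ℕ-pos k 0<x) (begin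
    x * x ^ℕ k   ≤⟨ h ⟩
    y * y ^ℕ k   ≤⟨ *-monoʳ-≤ 0≤y (^ℕ-monoˡ-≤ k 0≤y (proj₁ y<x)) ⟩
    y * x ^ℕ k   ∎)
    where
    0<x : 0# < x
    0<x = begin-strict 0# ≤⟨ 0≤y ⟩ y <⟨ y<x ⟩ x ∎

  -- Multiplying the inductive bound by `y` exceeds the next one by exactly n (y - 1)². Bases on
  -- both sides of 1 occur: above it in `powers-unbounded`, below it in `half-power`.
  bernoulli : ∀ {y} n → 0# ≤ y → 1# + fromℕ n * (y - 1#) ≤ y ^ℕ n
  bernoulli {y} ℕ.zero  0≤y = ≤-reflexive (solve 1 (λ d → :1 :+ :0 :* d := :1) refl (y - 1#))
  bernoulli {y} (suc n) 0≤y = begin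
    1# + (1# + fromℕ n) * (y - 1#)
      ≤⟨ ≤-difference (*-nonNeg (0≤fromℕ n) 0≤[y-1]²)
           (solve 2 (λ y n → y :* (:1 :+ n :* (y :- :1))
             := :1 :+ (:1 :+ n) :* (y :- :1) :+ n :* ((y :- :1) :* (y :- :1))) refl y (fromℕ n)) ⟩
    y * (1# + fromℕ n * (y - 1#))
      ≤⟨ *-monoʳ-≤ 0≤y (bernoulli n 0≤y) ⟩
    y * y ^ℕ n  ∎
    where
    0≤[y-1]² : 0# ≤ (y - 1#) * (y - 1#)
    0≤[y-1]² with total 0# (y - 1#)
    ... | inj₁ 0≤z = *-nonNeg 0≤z 0≤z
    ... | inj₂ z≤0 = ≤-trans (*-nonNeg 0≤-z 0≤-z)
                       (≤-reflexive (solve 1 (λ z → :- z :* :- z := z :* z) refl (y - 1#)))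
      where
      0≤-z : 0# ≤ - (y - 1#)
      0≤-z = ≤-trans (≤-reflexive (solve 0 (:0 := :- :0) refl)) (-‿anti-≤ z≤0)

  1^ℕ : ∀ n → 1# ^ℕ n ≈ 1#
  1^ℕ ℕ.zero  = refl
  1^ℕ (suc n) = trans (*-identityˡ _) (1^ℕ n)

  x<y⇒0<y-x : ∀ {x y} → x < y → 0# < y - x
  x<y⇒0<y-x {x} {y} (x≤y , x≉y) = x≤y⇒0≤y-x x≤y , λ 0≈y-x → x≉y (begin-equality
    x            ≈⟨ +-identityʳ x ⟨
    x + 0#       ≈⟨ +-congˡ 0≈y-x ⟩
    x + (y - x)  ≈⟨ solve 2 (λ x y → x :+ (y :- x) := y) refl x y ⟩
    y            ∎)

  powers-unbounded : ∀ C {r} → 1# < r → ∃ λ n → C < r ^ℕ suc n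
  powers-unbounded C {r} 1<r = n , (begin-strict
    C                             ≤⟨ C≤nd ⟩
    fromℕ n * (r - 1#)            ≤⟨ *-monoˡ-≤ (proj₁ 0<r-1) (fromℕ-mono-≤ (ℕ.n≤1+n n)) ⟩
    fromℕ (suc n) * (r - 1#)      <⟨ x<1+x _ ⟩
    1# + fromℕ (suc n) * (r - 1#) ≤⟨ bernoulli (suc n) (≤-trans 0≤1 (proj₁ 1<r)) ⟩
    r ^ℕ suc n                    ∎)
    where
    0<r-1 : 0# < r - 1#
    0<r-1 = x<y⇒0<y-x 1<r
    n : ℕ
    n = proj₁ (archimedes-* C 0<r-1)
    C≤nd : C ≤ fromℕ n * (r - 1#)
    C≤nd = proj₂ (archimedes-* C 0<r-1)

  -- If `x` exceeded `y`, the powers of the ratio x / y would outgrow `C`. Thus estimates of all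
  -- powers up to one fixed factor suffice to compare the numbers themselves.
  ≤-from-powers : ∀ {x y} C → 0# ≤ x → 0# < y →
    (∀ k → x ^ℕ suc k ≤ C * y ^ℕ suc k) → x ≤ y
  ≤-from-powers {x} {y} C 0≤x 0<y h with positive-inverse 0<y
  ... | e , 0<e , ye≈1 = *-cancelʳ-≤ 0<e (≤-trans xe≤1 (≤-reflexive (sym ye≈1)))
    where
    xe-power≤C : ∀ k → (x * e) ^ℕ suc k ≤ C
    xe-power≤C k = begin
      (x * e) ^ℕ suc k              ≈⟨ ^-distrib-* x e (suc k) ⟩
      x ^ℕ suc k * e ^ℕ suc k       ≤⟨ *-monoˡ-≤ (^ℕ-nonNeg (suc k) (proj₁ 0<e)) (h k) ⟩
      C * y ^ℕ suc k * e ^ℕ suc k   ≈⟨ *-assoc C _ _ ⟩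
      C * (y ^ℕ suc k * e ^ℕ suc k) ≈⟨ *-congˡ (^-distrib-* y e (suc k)) ⟨
      C * (y * e) ^ℕ suc k          ≈⟨ *-congˡ (^-congˡ (suc k) ye≈1) ⟩
      C * 1# ^ℕ suc k               ≈⟨ *-congˡ (1^ℕ (suc k)) ⟩
      C * 1#                        ≈⟨ *-identityʳ C ⟩
      C                             ∎
    xe≤1 : x * e ≤ 1#
    xe≤1 with ≤∨> (x * e) 1#
    ... | inj₁ xe≤1 = xe≤1
    ... | inj₂ 1<xe = contradiction (xe-power≤C (proj₁ (powers-unbounded C 1<xe)))
                                    (<⇒≱ (proj₂ (powers-unbounded C 1<xe)))

  -- For n = k + 1 the choice θ = 1 - 1 / (2 n) works, since Bernoulli gives θ^n ≥ 1 / 2. A supremum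
  -- can then be missed by the factor θ at the cost of a factor 2 in its n-th power, which stands in
  -- for n-th roots and continuity.
  half-power : ∀ k → ∃ λ θ → 0# < θ × θ < 1# × 1# ≤ 2# * θ ^ℕ suc k
  half-power k = θ , (0≤θ , 0≉θ) , θ<1 , 1≤2θⁿ
    where
    N : Carrier
    N = fromℕ (suc k)
    0<2N : 0# < 2# * N
    0<2N = *-pos (0<-≤-trans 0<1 (x≤x+y 0≤1)) (0<fromℕ-suc k)
    h θ : Carrier
    h = proj₁ (positive-inverse 0<2N)
    θ = 1# - h
    0<h : 0# < h
    0<h = proj₁ (proj₂ (positive-inverse 0<2N))
    2nh≈1 : 2# * N * h ≈ 1#
    2nh≈1 = proj₂ (proj₂ (positive-inverse 0<2N))
    h≤1 : h ≤ 1#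
    h≤1 = begin
      h              ≈⟨ *-identityˡ h ⟨
      1# * h         ≤⟨ *-monoˡ-≤ (proj₁ 0<h) (1≤fromℕ-suc k) ⟩
      N * h          ≤⟨ x≤x+y (*-nonNeg (0≤fromℕ (suc k)) (proj₁ 0<h)) ⟩
      N * h + N * h  ≈⟨ solve 2 (λ N h → N :* h :+ N :* h := (:1 :+ :1) :* N :* h) refl N h ⟩
      2# * N * h     ≈⟨ 2nh≈1 ⟩
      1#             ∎
    0≤θ : 0# ≤ θ
    0≤θ = x≤y⇒0≤y-x h≤1
    θ<1 : θ < 1#
    θ<1 = ≤-difference (proj₁ 0<h) (solve 1 (λ h → :1 := :1 :- h :+ h) refl h)
        , λ θ≈1 → <⇒≉0 0<h (begin-equality
            h                ≈⟨ solve 1 (λ h → h := :1 :- (:1 :- h)) refl h ⟩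
            1# - θ           ≈⟨ +-congˡ (-‿cong θ≈1) ⟩
            1# - 1#          ≈⟨ -‿inverseʳ 1# ⟩
            0#               ∎)
    1≤2θⁿ : 1# ≤ 2# * θ ^ℕ suc k
    1≤2θⁿ = begin
      1#                          ≈⟨ solve 0 (:1 := :1 :+ :1 :- :1) refl ⟩
      2# - 1#                     ≈⟨ +-congˡ (-‿cong 2nh≈1) ⟨
      2# - 2# * N * h             ≈⟨ solve 2 (λ N h → :1 :+ :1 :- (:1 :+ :1) :* N :* h
                                       := (:1 :+ :1) :* (:1 :+ N :* (:1 :- h :- :1))) refl N h ⟩
      2# * (1# + N * (θ - 1#))    ≤⟨ *-monoʳ-≤ (+-nonNeg 0≤1 0≤1) (bernoulli (suc k) 0≤θ) ⟩
      2# * θ ^ℕ suc k             ∎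
    0≉θ : ¬ 0# ≈ θ
    0≉θ 0≈θ = <⇒≱ 0<1 (begin
      1#                     ≤⟨ 1≤2θⁿ ⟩
      2# * (θ * θ ^ℕ k)      ≈⟨ *-congˡ (*-congʳ 0≈θ) ⟨
      2# * (0# * θ ^ℕ k)     ≈⟨ solve 1 (λ z → (:1 :+ :1) :* (:0 :* z) := :0) refl (θ ^ℕ k) ⟩
      0#                     ∎)

-- Real powers characterised by integer powers

module RealPowers {ℓ} (em : ExcludedMiddle ℓ) (ℝ : CompleteOrderedField ℓ) where
  open CompleteOrderedField ℝ
  open RealOperations em ℝ
  open OrderedField em ℝ
  open IntegerCoefficients commutativeRing
    using (solve; _:*_; _:=_)
  open Exp commutativeSemiring using (^-distrib-*; ^-assocʳ; ^-congˡ; ^-homo-*)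
    renaming (_^_ to _^ℕ_)
  open Mult semiring using (×-homo-+; ×1-homo-*)
  open IsTotalOrder isTotalOrder using (antisym; total)
    renaming (trans to ≤-trans; reflexive to ≤-reflexive)
  open PosetReasoning poset

  sup-isSupremum : ∀ P → ∃ P → ∃ (IsUpperBound P) → IsSupremum P (sup P)
  sup-isSupremum P nonempty bounded with em {∃ P × ∃ (IsUpperBound P)}
  ... | yes (nonempty′ , bounded′) = proj₂ (complete P nonempty′ bounded′)
  ... | no  not                    = contradiction (nonempty , bounded) not

  -- x behaves like b ^ a: up to a factor C that does not depend on n, the power
  -- x ^ n agrees with b ^ ⌊ n a ⌋.  This determines x, and it is preserved by
  -- products and inverses of both b and x, for b on either side of 1.
  record IsPower (b a x : Carrier) : Set ℓ where
    field
      positive : 0# < x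
      C        : Carrier
      0≤C      : 0# ≤ C
      lower    : ∀ k m → fromℕ m ≤ fromℕ (suc k) * a → fromℕ (suc k) * a ≤ fromℕ (suc m) →
                 b ^ℕ m ≤ C * x ^ℕ suc k
      upper    : ∀ k m → fromℕ m ≤ fromℕ (suc k) * a → fromℕ (suc k) * a ≤ fromℕ (suc m) →
                 x ^ℕ suc k ≤ C * b ^ℕ m

  open IsPower

  module _ {b a : Carrier} (1≤b : 1# ≤ b) (0≤a : 0# ≤ a) where
    private
      0≤b : 0# ≤ b
      0≤b = ≤-trans 0≤1 1≤b

      P : Carrier
      P = sup (BelowPower b a)

      1∈ : BelowPower b a 1#
      1∈ = 0 , 0 , *-nonNeg (0≤fromℕ 1) 0≤a , 0≤1 , ≤-reflexive (*-identityˡ 1#)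

    -- Here m′ / n′ ≤ a ≤ m / n with n = k + 1 and n′ = k′ + 1. After raising both sides to the
    -- power n′, the claim reduces to m′ n ≤ m n′ in the exponent of `b`.
    BelowPower-bound : ∀ k m {t} → fromℕ (suc k) * a ≤ fromℕ m → BelowPower b a t →
                       t ^ℕ suc k ≤ b ^ℕ m
    BelowPower-bound k m {t} na≤m (m′ , k′ , m′≤n′a , 0≤t , tⁿ≤bᵐ) =
      ^ℕ-cancelˡ-≤ k′ (^ℕ-nonNeg (suc k) 0≤t) (^ℕ-nonNeg m 0≤b) (begin
        (t ^ℕ suc k) ^ℕ suc k′  ≈⟨ ^-assocʳ t (suc k) (suc k′) ⟩
        t ^ℕ (suc k ℕ.* suc k′) ≡⟨ ≡.cong (t ^ℕ_) (ℕ.*-comm (suc k) (suc k′)) ⟩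
        t ^ℕ (suc k′ ℕ.* suc k) ≈⟨ ^-assocʳ t (suc k′) (suc k) ⟨
        (t ^ℕ suc k′) ^ℕ suc k  ≤⟨ ^ℕ-monoˡ-≤ (suc k) (^ℕ-nonNeg (suc k′) 0≤t) tⁿ≤bᵐ ⟩
        (b ^ℕ m′) ^ℕ suc k      ≈⟨ ^-assocʳ b m′ (suc k) ⟩
        b ^ℕ (m′ ℕ.* suc k)     ≤⟨ ^ℕ-monoʳ-≤ 1≤b (fromℕ-cancel-≤ (m′ ℕ.* suc k) (m ℕ.* suc k′) m′n≤mn′) ⟩
        b ^ℕ (m ℕ.* suc k′)     ≈⟨ ^-assocʳ b m (suc k′) ⟨
        (b ^ℕ m) ^ℕ suc k′      ∎)
      where
      m′n≤mn′ : fromℕ (m′ ℕ.* suc k) ≤ fromℕ (m ℕ.* suc k′)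
      m′n≤mn′ = begin
        fromℕ (m′ ℕ.* suc k)                    ≈⟨ ×1-homo-* m′ (suc k) ⟩
        fromℕ m′ * fromℕ (suc k)                ≤⟨ *-monoˡ-≤ (0≤fromℕ (suc k)) m′≤n′a ⟩
        fromℕ (suc k′) * a * fromℕ (suc k)
          ≈⟨ solve 3 (λ x y z → x :* y :* z := (z :* y) :* x) refl (fromℕ (suc k′)) a (fromℕ (suc k)) ⟩
        fromℕ (suc k) * a * fromℕ (suc k′)      ≤⟨ *-monoˡ-≤ (0≤fromℕ (suc k′)) na≤m ⟩
        fromℕ m * fromℕ (suc k′)                ≈⟨ ×1-homo-* m (suc k′) ⟨
        fromℕ (m ℕ.* suc k′)                    ∎

    private
      bounded : ∃ (IsUpperBound (BelowPower b a))
      bounded = b ^ℕ proj₁ (archimedes a) , λ t t∈ → begin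
        t          ≈⟨ *-identityʳ t ⟨
        t ^ℕ 1     ≤⟨ BelowPower-bound 0 (proj₁ (archimedes a)) (begin
          fromℕ 1 * a                   ≈⟨ *-congʳ (+-identityʳ 1#) ⟩
          1# * a                        ≈⟨ *-identityˡ a ⟩
          a                             ≤⟨ proj₂ (archimedes a) ⟩
          fromℕ (proj₁ (archimedes a))  ∎) t∈ ⟩
        b ^ℕ proj₁ (archimedes a)  ∎

      P-sup : IsSupremum (BelowPower b a) P
      P-sup = sup-isSupremum (BelowPower b a) (1# , 1∈) bounded

    1≤sup-BelowPower : 1# ≤ sup (BelowPower b a)
    1≤sup-BelowPower = proj₁ P-sup 1# 1∈

    private
      0<P : 0# < P
      0<P = 0<-≤-trans 0<1 1≤sup-BelowPower

      θP<P : ∀ {θ} → θ < 1# → ¬ P ≤ θ * P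
      θP<P {θ} θ<1 P≤θP = <⇒≱ θ<1 (*-cancelʳ-≤ 0<P (≤-trans (≤-reflexive (*-identityˡ P)) P≤θP))

      -- Otherwise P / θ, whose n-th power is at most 2 P^n, would still lie in `BelowPower b a`,
      -- although it exceeds the supremum `P`.
      P-lower : ∀ k m → fromℕ m ≤ fromℕ (suc k) * a → b ^ℕ m ≤ 2# * P ^ℕ suc k
      P-lower k m m≤na = [ (λ h → h) , (λ h → ⊥-elim (absurd h)) ]′ (≤∨> _ _)
        where
        θ e : Carrier
        θ = proj₁ (half-power k)
        0<θ : 0# < θ
        0<θ = proj₁ (proj₂ (half-power k))
        e = proj₁ (positive-inverse 0<θ)
        0<e : 0# < e
        0<e = proj₁ (proj₂ (positive-inverse 0<θ))
        θe≈1 : θ * e ≈ 1#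
        θe≈1 = proj₂ (proj₂ (positive-inverse 0<θ))
        eⁿ≤2 : e ^ℕ suc k ≤ 2#
        eⁿ≤2 = begin
          e ^ℕ suc k                      ≈⟨ *-identityˡ _ ⟨
          1# * e ^ℕ suc k                 ≤⟨ *-monoˡ-≤ (^ℕ-nonNeg (suc k) (proj₁ 0<e))
                                               (proj₂ (proj₂ (proj₂ (half-power k)))) ⟩
          2# * θ ^ℕ suc k * e ^ℕ suc k    ≈⟨ *-assoc 2# _ _ ⟩
          2# * (θ ^ℕ suc k * e ^ℕ suc k)  ≈⟨ *-congˡ (^-distrib-* θ e (suc k)) ⟨
          2# * (θ * e) ^ℕ suc k           ≈⟨ *-congˡ (^-congˡ (suc k) θe≈1) ⟩
          2# * 1# ^ℕ suc k                ≈⟨ *-congˡ (1^ℕ (suc k)) ⟩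
          2# * 1#                         ≈⟨ *-identityʳ 2# ⟩
          2#                              ∎
        absurd : ¬ 2# * P ^ℕ suc k < b ^ℕ m
        absurd h = θP<P (proj₁ (proj₂ (proj₂ (half-power k)))) (begin
          P            ≈⟨ *-identityˡ P ⟨
          1# * P       ≈⟨ *-congʳ θe≈1 ⟨
          θ * e * P    ≈⟨ *-assoc θ e P ⟩
          θ * (e * P)  ≤⟨ *-monoʳ-≤ (proj₁ 0<θ) (proj₁ P-sup (e * P) (m , k , m≤na
                            , *-nonNeg (proj₁ 0<e) (proj₁ 0<P) , (begin
              (e * P) ^ℕ suc k          ≈⟨ ^-distrib-* e P (suc k) ⟩
              e ^ℕ suc k * P ^ℕ suc k   ≤⟨ *-monoˡ-≤ (^ℕ-nonNeg (suc k) (proj₁ 0<P)) eⁿ≤2 ⟩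
              2# * P ^ℕ suc k           ≤⟨ proj₁ h ⟩
              b ^ℕ m                    ∎))) ⟩
          θ * P        ∎)

      -- Some member `t` of `BelowPower b a` reaches θ P, for otherwise θ P would be a smaller upper
      -- bound; then P^n ≤ 2 (θ P)^n ≤ 2 t^n ≤ 2 b^m.
      P-upper : ∀ k m → fromℕ (suc k) * a ≤ fromℕ m → P ^ℕ suc k ≤ 2# * b ^ℕ m
      P-upper k m na≤m = case-near (em {∃ λ t → BelowPower b a t × θ * P ≤ t})
        where
        θ : Carrier
        θ = proj₁ (half-power k)
        0<θ : 0# < θ
        0<θ = proj₁ (proj₂ (half-power k))
        case-near : Dec (∃ λ t → BelowPower b a t × θ * P ≤ t) → P ^ℕ suc k ≤ 2# * b ^ℕ m
        case-near (yes (t , t∈ , θP≤t)) = begin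
          P ^ℕ suc k                        ≈⟨ *-identityˡ _ ⟨
          1# * P ^ℕ suc k                   ≤⟨ *-monoˡ-≤ (^ℕ-nonNeg (suc k) (proj₁ 0<P))
                                                 (proj₂ (proj₂ (proj₂ (half-power k)))) ⟩
          2# * θ ^ℕ suc k * P ^ℕ suc k      ≈⟨ *-assoc 2# _ _ ⟩
          2# * (θ ^ℕ suc k * P ^ℕ suc k)    ≈⟨ *-congˡ (^-distrib-* θ P (suc k)) ⟨
          2# * (θ * P) ^ℕ suc k             ≤⟨ *-monoʳ-≤ (+-nonNeg 0≤1 0≤1)
                                                 (≤-trans (^ℕ-monoˡ-≤ (suc k) (*-nonNeg (proj₁ 0<θ) (proj₁ 0<P)) θP≤t)
                                                          (BelowPower-bound k m na≤m t∈)) ⟩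
          2# * b ^ℕ m                       ∎
        case-near (no none) = contradiction
          (proj₂ P-sup (θ * P) λ t t∈ → [ (λ t≤θP → t≤θP) , (λ θP≤t → contradiction (t , t∈ , θP≤t) none) ]′
            (total t (θ * P)))
          (θP<P (proj₁ (proj₂ (proj₂ (half-power k)))))

    isPower-sup : IsPower b a (sup (BelowPower b a))
    isPower-sup = record
      { positive = 0<P
      -- The 2 comes from `half-power`. The factor `b` comes from the upper estimate, which is
      -- available only at the exponent m + 1; in the lower one it is padding by `1# ≤ b`.
      ; C        = 2# * b
      ; 0≤C      = *-nonNeg 0≤2 0≤b
      ; lower    = λ k m m≤na _ → begin
          b ^ℕ m                      ≤⟨ P-lower k m m≤na ⟩
          2# * P ^ℕ suc k             ≈⟨ *-identityʳ _ ⟨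
          2# * P ^ℕ suc k * 1#        ≤⟨ *-monoʳ-≤ (*-nonNeg 0≤2 (^ℕ-nonNeg (suc k) (proj₁ 0<P))) 1≤b ⟩
          2# * P ^ℕ suc k * b         ≈⟨ solve 3 (λ x y z → x :* y :* z := x :* z :* y) refl 2# (P ^ℕ suc k) b ⟩
          2# * b * P ^ℕ suc k         ∎
      ; upper    = λ k m _ na≤1+m → ≤-trans (P-upper k (suc m) na≤1+m) (≤-reflexive (sym (*-assoc 2# b _)))
      }
      where
      0≤2 : 0# ≤ 2#
      0≤2 = +-nonNeg 0≤1 0≤1

  -- Both powers are compared with the same b^m, where m is a floor of n a, and this gives x^n ≤ C
  -- y^n for all n. Bases and exponents agree only up to `≈`, so that `isPower-unique` also provides
  -- the congruence of `_^_`.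
  isPower-≤ : ∀ {b b′ a a′ x y} → b ≈ b′ → a ≈ a′ → 0# ≤ a →
              IsPower b a x → IsPower b′ a′ y → x ≤ y
  isPower-≤ {b} {b′} {a} {a′} {x} {y} b≈b′ a≈a′ 0≤a X Y =
    ≤-from-powers (C X * C Y) (proj₁ (positive X)) (positive Y) λ k →
      let (m , m≤na , na≤1+m) = floor (*-nonNeg (0≤fromℕ (suc k)) 0≤a)
          na≈na′ = *-congˡ a≈a′
      in begin
        x ^ℕ suc k                ≤⟨ upper X k m m≤na na≤1+m ⟩
        C X * b ^ℕ m              ≈⟨ *-congˡ (^-congˡ m b≈b′) ⟩
        C X * b′ ^ℕ m             ≤⟨ *-monoʳ-≤ (0≤C X) (lower Y k m
                                       (≤-trans m≤na (≤-reflexive na≈na′))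
                                       (≤-trans (≤-reflexive (sym na≈na′)) na≤1+m)) ⟩
        C X * (C Y * y ^ℕ suc k)  ≈⟨ *-assoc (C X) (C Y) _ ⟨
        C X * C Y * y ^ℕ suc k    ∎

  isPower-unique : ∀ {b b′ a a′ x y} → b ≈ b′ → a ≈ a′ → 0# ≤ a →
                   IsPower b a x → IsPower b′ a′ y → x ≈ y
  isPower-unique b≈b′ a≈a′ 0≤a X Y = antisym
    (isPower-≤ b≈b′ a≈a′ 0≤a X Y)
    (isPower-≤ (sym b≈b′) (sym a≈a′) (≤-trans 0≤a (≤-reflexive a≈a′)) Y X)

  isPower-* : ∀ {b c a x y} → 0# ≤ b → 0# ≤ c → IsPower b a x → IsPower c a y →
              IsPower (b * c) a (x * y)
  isPower-* {b} {c} {a} {x} {y} 0≤b 0≤c X Y = record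
    { positive = *-pos (positive X) (positive Y)
    ; C        = C X * C Y
    ; 0≤C      = *-nonNeg (0≤C X) (0≤C Y)
    ; lower    = λ k m m≤na na≤1+m → begin
        (b * c) ^ℕ m                               ≈⟨ ^-distrib-* b c m ⟩
        b ^ℕ m * c ^ℕ m                            ≤⟨ *-mono-≤ (^ℕ-nonNeg m 0≤b) (lower X k m m≤na na≤1+m)
                                                              (^ℕ-nonNeg m 0≤c) (lower Y k m m≤na na≤1+m) ⟩
        (C X * x ^ℕ suc k) * (C Y * y ^ℕ suc k)    ≈⟨ interchange _ _ _ _ ⟩
        C X * C Y * (x ^ℕ suc k * y ^ℕ suc k)      ≈⟨ *-congˡ (^-distrib-* x y (suc k)) ⟨
        C X * C Y * (x * y) ^ℕ suc k               ∎
    ; upper    = λ k m m≤na na≤1+m → begin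
        (x * y) ^ℕ suc k                           ≈⟨ ^-distrib-* x y (suc k) ⟩
        x ^ℕ suc k * y ^ℕ suc k                    ≤⟨ *-mono-≤ (^ℕ-nonNeg (suc k) (proj₁ (positive X))) (upper X k m m≤na na≤1+m)
                                                              (^ℕ-nonNeg (suc k) (proj₁ (positive Y))) (upper Y k m m≤na na≤1+m) ⟩
        (C X * b ^ℕ m) * (C Y * c ^ℕ m)            ≈⟨ interchange _ _ _ _ ⟩
        C X * C Y * (b ^ℕ m * c ^ℕ m)              ≈⟨ *-congˡ (^-distrib-* b c m) ⟨
        C X * C Y * (b * c) ^ℕ m                   ∎
    }
    where
    interchange : ∀ u v w z → (u * v) * (w * z) ≈ u * w * (v * z)
    interchange = solve 4 (λ u v w z → (u :* v) :* (w :* z) := u :* w :* (v :* z)) refl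

  -- Taking reciprocals exchanges the lower and the upper estimate while the exponents and the
  -- constant stay. This carries the case of bases at least 1 over to bases below 1.
  isPower-inverse : ∀ {b c a x y} → 0# ≤ c → b * c ≈ 1# → 0# < y → x * y ≈ 1# →
                    IsPower b a x → IsPower c a y
  isPower-inverse {b} {c} {a} {x} {y} 0≤c bc≈1 0<y xy≈1 X = record
    { positive = 0<y
    ; C        = C X
    ; 0≤C      = 0≤C X
    ; lower    = λ k m m≤na na≤1+m →
        flip-≤ (suc k) m xy≈1 bc≈1 (proj₁ 0<y) 0≤c (upper X k m m≤na na≤1+m)
    ; upper    = λ k m m≤na na≤1+m →
        flip-≤ m (suc k) bc≈1 xy≈1 0≤c (proj₁ 0<y) (lower X k m m≤na na≤1+m)
    }
    where
    powers-inverse : ∀ {u v} n → u * v ≈ 1# → u ^ℕ n * v ^ℕ n ≈ 1#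
    powers-inverse {u} {v} n uv≈1 =
      trans (sym (^-distrib-* u v n)) (trans (^-congˡ n uv≈1) (1^ℕ n))
    flip-≤ : ∀ {u u′ v v′} i j → u * u′ ≈ 1# → v * v′ ≈ 1# → 0# ≤ u′ → 0# ≤ v′ →
             u ^ℕ i ≤ C X * v ^ℕ j → v′ ^ℕ j ≤ C X * u′ ^ℕ i
    flip-≤ {u} {u′} {v} {v′} i j uu′≈1 vv′≈1 0≤u′ 0≤v′ h = begin
      v′ ^ℕ j                                 ≈⟨ *-identityˡ _ ⟨
      1# * v′ ^ℕ j                            ≈⟨ *-congʳ (powers-inverse i uu′≈1) ⟨
      u ^ℕ i * u′ ^ℕ i * v′ ^ℕ j              ≤⟨ *-monoˡ-≤ (^ℕ-nonNeg j 0≤v′) (*-monoˡ-≤ (^ℕ-nonNeg i 0≤u′) h) ⟩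
      C X * v ^ℕ j * u′ ^ℕ i * v′ ^ℕ j
        ≈⟨ solve 4 (λ C v u v′ → C :* v :* u :* v′ := C :* u :* (v :* v′)) refl (C X) (v ^ℕ j) (u′ ^ℕ i) (v′ ^ℕ j) ⟩
      C X * u′ ^ℕ i * (v ^ℕ j * v′ ^ℕ j)      ≈⟨ *-congˡ (powers-inverse j vv′≈1) ⟩
      C X * u′ ^ℕ i * 1#                      ≈⟨ *-identityʳ _ ⟩
      C X * u′ ^ℕ i                           ∎

  isPower-1 : ∀ {b} → 1# ≤ b → IsPower b 1# b
  isPower-1 {b} 1≤b = record
    { positive = 0<-≤-trans 0<1 1≤b
    -- From n ≤ m + 1 the upper estimate loses one factor `b`, because `m` may be n - 1.
    ; C        = b
    ; 0≤C      = ≤-trans 0≤1 1≤b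
    ; lower    = λ k m m≤n·1 _ → begin
        b ^ℕ m           ≤⟨ ^ℕ-monoʳ-≤ 1≤b (ℕ.m≤n⇒m≤1+n (fromℕ-cancel-≤ m (suc k) (≤-trans m≤n·1 (≤-reflexive (*-identityʳ _))))) ⟩
        b * b ^ℕ suc k   ∎
    ; upper    = λ k m _ n·1≤1+m →
        ^ℕ-monoʳ-≤ 1≤b (fromℕ-cancel-≤ (suc k) (suc m) (≤-trans (≤-reflexive (sym (*-identityʳ _))) n·1≤1+m))
    }

  isPower-+ : ∀ {b a a′ x y} → 1# ≤ b → 0# ≤ a → 0# ≤ a′ → IsPower b a x → IsPower b a′ y →
              IsPower b (a + a′) (x * y)
  isPower-+ {b} {a} {a′} {x} {y} 1≤b 0≤a 0≤a′ X Y = record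
    { positive = *-pos (positive X) (positive Y)
    -- The floors `m₁` and `m₂` add up to a floor of n (a + a′) only up to rounding: m ≤ m₁ + m₂ + 2
    -- and m₁ + m₂ ≤ m + 1. The first accounts for the two factors `b`.
    ; C        = b * b * (C X * C Y)
    ; 0≤C      = *-nonNeg (*-nonNeg 0≤b 0≤b) (*-nonNeg (0≤C X) (0≤C Y))
    ; lower    = λ k m m≤n[a+a′] _ → lower′ k m m≤n[a+a′]
    ; upper    = λ k m _ n[a+a′]≤1+m → upper′ k m n[a+a′]≤1+m
    }
    where
    0≤b : 0# ≤ b
    0≤b = ≤-trans 0≤1 1≤b
    module _ (k : ℕ) where
      n : Carrier
      n = fromℕ (suc k)
      0≤na : 0# ≤ n * a
      0≤na = *-nonNeg (0≤fromℕ (suc k)) 0≤a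
      0≤na′ : 0# ≤ n * a′
      0≤na′ = *-nonNeg (0≤fromℕ (suc k)) 0≤a′
      m₁ m₂ : ℕ
      m₁ = proj₁ (floor 0≤na)
      m₂ = proj₁ (floor 0≤na′)
      m₁≤na : fromℕ m₁ ≤ n * a
      m₁≤na = proj₁ (proj₂ (floor 0≤na))
      na≤1+m₁ : n * a ≤ fromℕ (suc m₁)
      na≤1+m₁ = proj₂ (proj₂ (floor 0≤na))
      m₂≤na′ : fromℕ m₂ ≤ n * a′
      m₂≤na′ = proj₁ (proj₂ (floor 0≤na′))
      na′≤1+m₂ : n * a′ ≤ fromℕ (suc m₂)
      na′≤1+m₂ = proj₂ (proj₂ (floor 0≤na′))

      lower′ : ∀ m → fromℕ m ≤ n * (a + a′) → b ^ℕ m ≤ b * b * (C X * C Y) * (x * y) ^ℕ suc k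
      lower′ m h = begin
        b ^ℕ m                                   ≤⟨ ^ℕ-monoʳ-≤ 1≤b (fromℕ-cancel-≤ m (suc m₁ ℕ.+ suc m₂) m≤) ⟩
        b ^ℕ (suc m₁ ℕ.+ suc m₂)                 ≈⟨ ^-homo-* b (suc m₁) (suc m₂) ⟩
        b ^ℕ suc m₁ * b ^ℕ suc m₂
          ≈⟨ solve 3 (λ b u v → (b :* u) :* (b :* v) := b :* b :* (u :* v)) refl b (b ^ℕ m₁) (b ^ℕ m₂) ⟩
        b * b * (b ^ℕ m₁ * b ^ℕ m₂)              ≤⟨ *-monoʳ-≤ (*-nonNeg 0≤b 0≤b)
                                                      (*-mono-≤ (^ℕ-nonNeg m₁ 0≤b) (lower X k m₁ m₁≤na na≤1+m₁)
                                                                (^ℕ-nonNeg m₂ 0≤b) (lower Y k m₂ m₂≤na′ na′≤1+m₂)) ⟩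
        b * b * ((C X * x ^ℕ suc k) * (C Y * y ^ℕ suc k))
          ≈⟨ solve 5 (λ b c d u v → b :* ((c :* u) :* (d :* v)) := b :* (c :* d) :* (u :* v)) refl
               (b * b) (C X) (C Y) (x ^ℕ suc k) (y ^ℕ suc k) ⟩
        b * b * (C X * C Y) * (x ^ℕ suc k * y ^ℕ suc k)   ≈⟨ *-congˡ (^-distrib-* x y (suc k)) ⟨
        b * b * (C X * C Y) * (x * y) ^ℕ suc k   ∎
        where
        m≤ : fromℕ m ≤ fromℕ (suc m₁ ℕ.+ suc m₂)
        m≤ = begin
          fromℕ m                           ≤⟨ h ⟩
          n * (a + a′)                      ≈⟨ distribˡ n a a′ ⟩
          n * a + n * a′                    ≤⟨ +-mono-≤ na≤1+m₁ na′≤1+m₂ ⟩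
          fromℕ (suc m₁) + fromℕ (suc m₂)   ≈⟨ ×-homo-+ 1# (suc m₁) (suc m₂) ⟨
          fromℕ (suc m₁ ℕ.+ suc m₂)         ∎

      upper′ : ∀ m → n * (a + a′) ≤ fromℕ (suc m) → (x * y) ^ℕ suc k ≤ b * b * (C X * C Y) * b ^ℕ m
      upper′ m h = begin
        (x * y) ^ℕ suc k                       ≈⟨ ^-distrib-* x y (suc k) ⟩
        x ^ℕ suc k * y ^ℕ suc k                ≤⟨ *-mono-≤ (^ℕ-nonNeg (suc k) (proj₁ (positive X))) (upper X k m₁ m₁≤na na≤1+m₁)
                                                            (^ℕ-nonNeg (suc k) (proj₁ (positive Y))) (upper Y k m₂ m₂≤na′ na′≤1+m₂) ⟩
        (C X * b ^ℕ m₁) * (C Y * b ^ℕ m₂)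
          ≈⟨ solve 4 (λ c d u v → (c :* u) :* (d :* v) := c :* d :* (u :* v)) refl (C X) (C Y) (b ^ℕ m₁) (b ^ℕ m₂) ⟩
        C X * C Y * (b ^ℕ m₁ * b ^ℕ m₂)        ≈⟨ *-congˡ (^-homo-* b m₁ m₂) ⟨
        C X * C Y * b ^ℕ (m₁ ℕ.+ m₂)           ≤⟨ *-monoʳ-≤ (*-nonNeg (0≤C X) (0≤C Y)) (^ℕ-monoʳ-≤ 1≤b (ℕ.m≤n⇒m≤1+n (fromℕ-cancel-≤ (m₁ ℕ.+ m₂) (suc m) ≤m))) ⟩
        C X * C Y * b ^ℕ suc (suc m)
          ≈⟨ solve 3 (λ b c u → c :* (b :* (b :* u)) := b :* b :* c :* u) refl b (C X * C Y) (b ^ℕ m) ⟩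
        b * b * (C X * C Y) * b ^ℕ m           ∎
        where
        ≤m : fromℕ (m₁ ℕ.+ m₂) ≤ fromℕ (suc m)
        ≤m = begin
          fromℕ (m₁ ℕ.+ m₂)        ≈⟨ ×-homo-+ 1# m₁ m₂ ⟩
          fromℕ m₁ + fromℕ m₂      ≤⟨ +-mono-≤ m₁≤na m₂≤na′ ⟩
          n * a + n * a′           ≈⟨ distribˡ n a a′ ⟨
          n * (a + a′)             ≤⟨ h ⟩
          fromℕ (suc m)            ∎

-- Evaluating real powers

module SignedPower {ℓ} (em : ExcludedMiddle ℓ) (ℝ : CompleteOrderedField ℓ) where
  open CompleteOrderedField ℝ
  open RealOperations em ℝ
  open OrderedField em ℝ
  open RealPowers em ℝ
  open IsPower using (positive)
  open RingProperties ring using (-‿involutive) renaming (-0#≈0# to -0≈0)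
  open IntegerCoefficients commutativeRing
    using (solve; :0; :1; _:+_; _:*_; _:-_; :-_; _:=_)
  open IsTotalOrder isTotalOrder using (antisym)
    renaming (trans to ≤-trans; refl to ≤-refl; reflexive to ≤-reflexive)
  open PosetReasoning poset

  private
    1≤⁻¹ : ∀ {b} → 0# < b → ¬ 1# ≤ b → 1# ≤ b ⁻¹
    1≤⁻¹ {b} 0<b 1≰b = *-cancelʳ-≤ 0<b (begin
      1# * b     ≈⟨ *-identityˡ b ⟩
      b          ≤⟨ proj₁ (≰⇒> 1≰b) ⟩
      1#         ≈⟨ ⁻¹-inverseʳ (<⇒≉0 0<b) ⟨
      b * b ⁻¹   ≈⟨ *-comm b _ ⟩
      b ⁻¹ * b   ∎)

    ⁻¹-inverseˡ : ∀ {b} → 0# < b → b ⁻¹ * b ≈ 1#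
    ⁻¹-inverseˡ 0<b = trans (*-comm _ _) (⁻¹-inverseʳ (<⇒≉0 0<b))

  ≰⇒0≤- : ∀ {a} → ¬ 0# ≤ a → 0# ≤ - a
  ≰⇒0≤- {a} 0≰a = ≤-difference (x≤y⇒0≤y-x (proj₁ (≰⇒> 0≰a)))
    (solve 1 (λ a → :- a := :0 :+ (:0 :- a)) refl a)

  isPower-^ : ∀ {b a} → 0# < b → 0# ≤ a → IsPower b a (b ^ a)
  isPower-^ {b} {a} 0<b 0≤a with 1# ≤? b | 0# ≤? a
  ... | yes 1≤b | yes _   = isPower-sup 1≤b 0≤a
  ... | no  1≰b | yes _   =
    isPower-inverse (proj₁ 0<b) (⁻¹-inverseˡ 0<b)
      (⁻¹-pos (positive Q)) (⁻¹-inverseʳ (<⇒≉0 (positive Q))) Q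
    where
    Q : IsPower (b ⁻¹) a (sup (BelowPower (b ⁻¹) a))
    Q = isPower-sup (1≤⁻¹ 0<b 1≰b) 0≤a
  ... | _       | no  0≰a = contradiction 0≤a 0≰a

  -- The estimates of `IsPower` are indexed by naturals `m` below n a, so for negative `a` they
  -- would be vacuous. A negative power is therefore reached through its reciprocal `y`.
  isPower-^-neg : ∀ {b a} → 0# < b → ¬ 0# ≤ a → ∃ λ y → IsPower b (- a) y × y * b ^ a ≈ 1#
  isPower-^-neg {b} {a} 0<b 0≰a with 1# ≤? b | 0# ≤? a
  ... | yes 1≤b | no _    = _ , Q , ⁻¹-inverseʳ (<⇒≉0 (positive Q))
    where
    Q : IsPower b (- a) (sup (BelowPower b (- a)))
    Q = isPower-sup 1≤b (≰⇒0≤- 0≰a)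
  ... | no  1≰b | no _    =
      _ , isPower-inverse (proj₁ 0<b) (⁻¹-inverseˡ 0<b)
            (⁻¹-pos (positive Q)) (⁻¹-inverseʳ (<⇒≉0 (positive Q))) Q
        , ⁻¹-inverseˡ (positive Q)
    where
    Q : IsPower (b ⁻¹) (- a) (sup (BelowPower (b ⁻¹) (- a)))
    Q = isPower-sup (1≤⁻¹ 0<b 1≰b) (≰⇒0≤- 0≰a)
  ... | _       | yes 0≤a = contradiction 0≤a 0≰a

  1≤^ : ∀ {b a} → 1# ≤ b → 0# ≤ a → 1# ≤ b ^ a
  1≤^ {b} {a} 1≤b 0≤a with 1# ≤? b | 0# ≤? a
  ... | yes _   | yes _   = 1≤sup-BelowPower 1≤b 0≤a
  ... | no  1≰b | _       = contradiction 1≤b 1≰b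
  ... | yes _   | no  0≰a = contradiction 0≤a 0≰a

  ^-pos : ∀ {b} a → 0# < b → 0# < b ^ a
  ^-pos {b} a 0<b = by-cases em
    where
    by-cases : Dec (0# ≤ a) → 0# < b ^ a
    by-cases (yes 0≤a) = positive (isPower-^ 0<b 0≤a)
    by-cases (no  0≰a) = ≰⇒> λ b^a≤0 → <⇒≱ 0<1 (begin
      1#          ≈⟨ yb^a≈1 ⟨
      y * b ^ a   ≤⟨ *-monoʳ-≤ (proj₁ (positive Y)) b^a≤0 ⟩
      y * 0#      ≈⟨ zeroʳ y ⟩
      0#          ∎)
      where
      y : Carrier
      y = proj₁ (isPower-^-neg 0<b 0≰a)
      Y : IsPower b (- a) y
      Y = proj₁ (proj₂ (isPower-^-neg 0<b 0≰a))
      yb^a≈1 : y * b ^ a ≈ 1#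
      yb^a≈1 = proj₂ (proj₂ (isPower-^-neg 0<b 0≰a))

  -- (k s)^r = k^r s^r, multiplied by k so that no exponent of k is negative.
  ^-scale : ∀ {b k s r q} → 1# ≤ k → 0# < s → b ≈ k * s → q ≈ r + 1# → 0# ≤ q →
            b ^ r * k ≈ k ^ q * s ^ r
  ^-scale {b} {k} {s} {r} {q} 1≤k 0<s b≈ks q≈r+1 0≤q = by-cases em
    where
    0<k : 0# < k
    0<k = 0<-≤-trans 0<1 1≤k
    0<b : 0# < b
    0<b = 0<-≤-trans (*-pos 0<k 0<s) (≤-reflexive (sym b≈ks))

    by-cases : Dec (0# ≤ r) → b ^ r * k ≈ k ^ q * s ^ r
    by-cases (yes 0≤r) = begin-equality
      b ^ r * k              ≈⟨ *-congʳ b^r≈ ⟩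
      k ^ r * s ^ r * k      ≈⟨ solve 3 (λ x y z → x :* y :* z := x :* z :* y) refl (k ^ r) (s ^ r) k ⟩
      k ^ r * k * s ^ r      ≈⟨ *-congʳ k^q≈ ⟨
      k ^ q * s ^ r          ∎
      where
      b^r≈ : b ^ r ≈ k ^ r * s ^ r
      b^r≈ = isPower-unique b≈ks refl 0≤r (isPower-^ 0<b 0≤r)
        (isPower-* (proj₁ 0<k) (proj₁ 0<s) (isPower-^ 0<k 0≤r) (isPower-^ 0<s 0≤r))
      k^q≈ : k ^ q ≈ k ^ r * k
      k^q≈ = isPower-unique refl q≈r+1 0≤q (isPower-^ 0<k 0≤q)
        (isPower-+ 1≤k 0≤r 0≤1 (isPower-^ 0<k 0≤r) (isPower-1 1≤k))
    -- For negative `r` the equation is multiplied by `y 0<b`, that is b^(-r). What remains rests on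
    -- -r + q = 1, whence k^(-r) k^q = k, a law for nonnegative exponents.
    by-cases (no 0≰r) = *-cancelʳ (positive (isPow 0<b)) (begin-equality
      b ^ r * k * (y 0<b)
        ≈⟨ solve 3 (λ u k y → u :* k :* y := y :* u :* k) refl (b ^ r) k (y 0<b) ⟩
      y 0<b * b ^ r * k                   ≈⟨ *-congʳ (y-inverse 0<b) ⟩
      1# * k                              ≈⟨ *-congˡ y*k^q≈k ⟨
      1# * (y 0<k * k ^ q)                ≈⟨ *-congʳ (y-inverse 0<s) ⟨
      y 0<s * s ^ r * (y 0<k * k ^ q)
        ≈⟨ solve 4 (λ a b c d → a :* b :* (c :* d) := d :* b :* (c :* a)) refl (y 0<s) (s ^ r) (y 0<k) (k ^ q) ⟩
      k ^ q * s ^ r * (y 0<k * y 0<s)     ≈⟨ *-congˡ y-* ⟨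
      k ^ q * s ^ r * y 0<b               ∎)
      where
      0≤-r : 0# ≤ - r
      0≤-r = ≰⇒0≤- 0≰r
      y : ∀ {c} → 0# < c → Carrier
      y 0<c = proj₁ (isPower-^-neg 0<c 0≰r)
      isPow : ∀ {c} (0<c : 0# < c) → IsPower c (- r) (y 0<c)
      isPow 0<c = proj₁ (proj₂ (isPower-^-neg 0<c 0≰r))
      y-inverse : ∀ {c} (0<c : 0# < c) → y 0<c * c ^ r ≈ 1#
      y-inverse 0<c = proj₂ (proj₂ (isPower-^-neg 0<c 0≰r))
      y-* : y 0<b ≈ y 0<k * y 0<s
      y-* = isPower-unique b≈ks refl 0≤-r (isPow 0<b)
        (isPower-* (proj₁ 0<k) (proj₁ 0<s) (isPow 0<k) (isPow 0<s))
      y*k^q≈k : y 0<k * k ^ q ≈ k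
      y*k^q≈k = isPower-unique refl
        (trans (+-congˡ q≈r+1) (solve 1 (λ r → :- r :+ (r :+ :1) := :1) refl r))
        (+-nonNeg 0≤-r 0≤q)
        (isPower-+ 1≤k 0≤-r 0≤q (isPow 0<k) (isPower-^ 0<k 0≤q)) (isPower-1 1≤k)

  if-yes : ∀ {a} {A : Set a} (d : Dec A) {x y : Carrier} → A → (if does d then x else y) ≡ x
  if-yes (yes _) _ = ≡.refl
  if-yes (no ¬a) a = contradiction a ¬a

  if-no : ∀ {a} {A : Set a} (d : Dec A) {x y : Carrier} → ¬ A → (if does d then x else y) ≡ y
  if-no (yes a) ¬a = contradiction a ¬a
  if-no (no _)  _  = ≡.refl

  0≤-⇒≤0 : ∀ {x} → 0# ≤ - x → x ≤ 0#
  0≤-⇒≤0 {x} 0≤-x = ≤-difference 0≤-x (solve 1 (λ x → :0 := x :+ :- x) refl x)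

  -- Absolute value

  abs-nonNeg : ∀ {x} → 0# ≤ x → abs x ≡ x
  abs-nonNeg {x} 0≤x = if-yes (0# ≤? x) 0≤x

  abs-neg : ∀ {x} → ¬ 0# ≤ x → abs x ≡ - x
  abs-neg {x} 0≰x = if-no (0# ≤? x) 0≰x

  abs-cases : ∀ x → (0# ≤ x × abs x ≡ x) ⊎ (0# ≤ - x × abs x ≡ - x)
  abs-cases x = by-cases em
    where
    by-cases : Dec (0# ≤ x) → (0# ≤ x × abs x ≡ x) ⊎ (0# ≤ - x × abs x ≡ - x)
    by-cases (yes 0≤x) = inj₁ (0≤x , abs-nonNeg 0≤x)
    by-cases (no  0≰x) = inj₂ (≰⇒0≤- 0≰x , abs-neg 0≰x)

  0≤abs : ∀ x → 0# ≤ abs x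
  0≤abs x with abs-cases x
  ... | inj₁ (0≤x  , eq) rewrite eq = 0≤x
  ... | inj₂ (0≤-x , eq) rewrite eq = 0≤-x

  x≤abs : ∀ x → x ≤ abs x
  x≤abs x with abs-cases x
  ... | inj₁ (0≤x  , eq) rewrite eq = ≤-refl
  ... | inj₂ (0≤-x , eq) rewrite eq = ≤-trans (0≤-⇒≤0 0≤-x) 0≤-x

  -x≤abs : ∀ x → - x ≤ abs x
  -x≤abs x with abs-cases x
  ... | inj₁ (0≤x  , eq) rewrite eq = ≤-trans (≤-trans (-‿anti-≤ 0≤x) (≤-reflexive -0≈0)) 0≤x
  ... | inj₂ (0≤-x , eq) rewrite eq = ≤-refl

  abs-least : ∀ {x c} → x ≤ c → - x ≤ c → abs x ≤ c
  abs-least {x} x≤c -x≤c with abs-cases x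
  ... | inj₁ (_ , eq) rewrite eq = x≤c
  ... | inj₂ (_ , eq) rewrite eq = -x≤c

  abs-+ : ∀ x y → abs (x + y) ≤ abs x + abs y
  abs-+ x y = abs-least (+-mono-≤ (x≤abs x) (x≤abs y))
    (≤-trans (≤-reflexive (solve 2 (λ x y → :- (x :+ y) := :- x :+ :- y) refl x y))
             (+-mono-≤ (-x≤abs x) (-x≤abs y)))

  abs-cong : ∀ {x y} → x ≈ y → abs x ≈ abs y
  abs-cong x≈y = antisym (half x≈y) (half (sym x≈y))
    where
    half : ∀ {x y} → x ≈ y → abs x ≤ abs y
    half {y = y} x≈y = abs-least (≤-trans (≤-reflexive x≈y) (x≤abs y))
                                 (≤-trans (≤-reflexive (-‿cong x≈y)) (-x≤abs y))

  abs-pos : ∀ {x} → ¬ x ≈ 0# → 0# < abs x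
  abs-pos {x} x≉0 = ≰⇒> λ abs≤0 → x≉0 (antisym (≤-trans (x≤abs x) abs≤0)
    (≤-trans (≤-reflexive (sym -0≈0)) (≤-trans (-‿anti-≤ (≤-trans (-x≤abs x) abs≤0)) (≤-reflexive (-‿involutive x)))))

  -- Homogeneity, monotonicity and oddness of φ

  module _ {p : Carrier} (1<p : 1# < p) where
    private
      r q : Carrier
      r = p - (1# + 1#)
      q = p - 1#

      0≤q : 0# ≤ q
      0≤q = x≤y⇒0≤y-x (proj₁ 1<p)

      q≈r+1 : q ≈ r + 1#
      q≈r+1 = solve 1 (λ p → p :- :1 := p :- (:1 :+ :1) :+ :1) refl p

      φ-of-pos : ∀ {t} → 0# < t → φ p t ≡ t ^ r * t
      φ-of-pos {t} 0<t = ≡.trans (if-no (t ≈? 0#) (<⇒≉0 0<t))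
        (≡.cong (λ u → u ^ r * t) (abs-nonNeg (proj₁ 0<t)))

      φ-of-neg : ∀ {t} → t < 0# → φ p t ≡ (- t) ^ r * t
      φ-of-neg {t} t<0 = ≡.trans (if-no (t ≈? 0#) (proj₂ t<0))
        (≡.cong (λ u → u ^ r * t) (abs-neg (<⇒≱ t<0)))

    φ-zero : ∀ {t} → t ≈ 0# → φ p t ≈ 0#
    φ-zero {t} t≈0 = reflexive (if-yes (t ≈? 0#) t≈0)

    φ-pos : ∀ {t} → 0# < t → 0# < φ p t
    φ-pos {t} 0<t = 0<-≤-trans (*-pos (^-pos r 0<t) 0<t) (≤-reflexive (reflexive (≡.sym (φ-of-pos 0<t))))

    -- The last factor of `t ^ r * t` supplies the `k` that `^-scale` asks for. The factors used
    -- later are the ratio t / s in `φ-mono-pos` and D + 1 in the final bound, both at least 1.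
    φ-scale : ∀ {t k s} → 1# ≤ k → 0# < s → t ≈ k * s → φ p t ≈ k ^ q * φ p s
    φ-scale {t} {k} {s} 1≤k 0<s t≈ks = begin-equality
      φ p t                ≡⟨ φ-of-pos 0<t ⟩
      t ^ r * t            ≈⟨ *-congˡ t≈ks ⟩
      t ^ r * (k * s)      ≈⟨ *-assoc _ k s ⟨
      t ^ r * k * s        ≈⟨ *-congʳ (^-scale 1≤k 0<s t≈ks q≈r+1 0≤q) ⟩
      k ^ q * s ^ r * s    ≈⟨ *-assoc _ _ s ⟩
      k ^ q * (s ^ r * s)  ≡⟨ ≡.cong (k ^ q *_) (φ-of-pos 0<s) ⟨
      k ^ q * φ p s        ∎
      where
      0<t : 0# < t
      0<t = 0<-≤-trans (*-pos (0<-≤-trans 0<1 1≤k) 0<s) (≤-reflexive (sym t≈ks))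

    -- For p < 2 the factor t^(p - 2) decreases, so the product cannot be treated factor by factor.
    -- With k = t / s ≥ 1, homogeneity reduces the claim to k^(p - 1) ≥ 1.
    φ-mono-pos : ∀ {s t} → 0# < s → s ≤ t → φ p s ≤ φ p t
    φ-mono-pos {s} {t} 0<s s≤t = begin
      φ p s          ≈⟨ *-identityˡ _ ⟨
      1# * φ p s     ≤⟨ *-monoˡ-≤ (proj₁ (φ-pos 0<s)) (1≤^ 1≤k 0≤q) ⟩
      k ^ q * φ p s  ≈⟨ φ-scale 1≤k 0<s (sym ks≈t) ⟨
      φ p t          ∎
      where
      k : Carrier
      k = t * s ⁻¹
      ks≈t : k * s ≈ t
      ks≈t = trans (*-assoc t _ s) (trans (*-congˡ (⁻¹-inverseˡ 0<s)) (*-identityʳ t))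
      1≤k : 1# ≤ k
      1≤k = *-cancelʳ-≤ 0<s (≤-trans (≤-reflexive (*-identityˡ s)) (≤-trans s≤t (≤-reflexive (sym ks≈t))))

    private
      -- Monotonicity in both directions replaces congruence of `_^_`, which cannot be read off from
      -- its definition by cases.
      φ-cong-pos : ∀ {s t} → 0# < s → s ≈ t → φ p s ≈ φ p t
      φ-cong-pos 0<s s≈t = antisym (φ-mono-pos 0<s (≤-reflexive s≈t))
        (φ-mono-pos (0<-≤-trans 0<s (≤-reflexive s≈t)) (≤-reflexive (sym s≈t)))

      φ-odd-neg : ∀ {t} → t < 0# → φ p (- t) ≈ - φ p t
      φ-odd-neg {t} t<0 = begin-equality
        φ p (- t)           ≡⟨ φ-of-pos (x<0⇒0<-x t<0) ⟩
        (- t) ^ r * - t     ≈⟨ solve 2 (λ x t → x :* :- t := :- (x :* t)) refl ((- t) ^ r) t ⟩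
        - ((- t) ^ r * t)   ≡⟨ ≡.cong -_ (φ-of-neg t<0) ⟨
        - φ p t             ∎

    φ-odd : ∀ t → φ p (- t) ≈ - φ p t
    φ-odd t with <-trichotomy-0 t
    ... | inj₂ (inj₂ t<0) = φ-odd-neg t<0
    ... | inj₂ (inj₁ t≈0) = begin-equality
      φ p (- t)  ≈⟨ φ-zero (trans (-‿cong t≈0) -0≈0) ⟩
      0#         ≈⟨ -0≈0 ⟨
      - 0#       ≈⟨ -‿cong (φ-zero t≈0) ⟨
      - φ p t    ∎
    ... | inj₁ 0<t = begin-equality
      φ p (- t)      ≈⟨ -‿involutive _ ⟨
      - - φ p (- t)  ≈⟨ -‿cong (φ-odd-neg (-t≤0 , λ -t≈0 → <⇒≉0 0<t (trans (sym (-‿involutive t)) (trans (-‿cong -t≈0) -0≈0)))) ⟨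
      - φ p (- - t)  ≈⟨ -‿cong (φ-cong-pos 0<t (sym (-‿involutive t))) ⟨
      - φ p t        ∎
      where
      -t≤0 : - t ≤ 0#
      -t≤0 = ≤-trans (-‿anti-≤ (proj₁ 0<t)) (≤-reflexive -0≈0)

    φ-cong : ∀ {s t} → s ≈ t → φ p s ≈ φ p t
    φ-cong {s} {t} s≈t with <-trichotomy-0 s
    ... | inj₁ 0<s        = φ-cong-pos 0<s s≈t
    ... | inj₂ (inj₁ s≈0) = trans (φ-zero s≈0) (sym (φ-zero (trans (sym s≈t) s≈0)))
    ... | inj₂ (inj₂ s<0) = begin-equality
      φ p s          ≈⟨ -‿involutive _ ⟨
      - - φ p s      ≈⟨ -‿cong (φ-odd s) ⟨
      - φ p (- s)    ≈⟨ -‿cong (φ-cong-pos (x<0⇒0<-x s<0) (-‿cong s≈t)) ⟩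
      - φ p (- t)    ≈⟨ -‿cong (φ-odd t) ⟩
      - - φ p t      ≈⟨ -‿involutive _ ⟩
      φ p t          ∎

    φ-nonNeg : ∀ {t} → 0# ≤ t → 0# ≤ φ p t
    φ-nonNeg {t} 0≤t with <-trichotomy-0 t
    ... | inj₁ 0<t              = proj₁ (φ-pos 0<t)
    ... | inj₂ (inj₁ t≈0)       = ≤-reflexive (sym (φ-zero t≈0))
    ... | inj₂ (inj₂ t<0)       = contradiction 0≤t (<⇒≱ t<0)

    φ-nonzero : ∀ {t} → ¬ t ≈ 0# → ¬ φ p t ≈ 0#
    φ-nonzero {t} t≉0 φt≈0 with <-trichotomy-0 t
    ... | inj₁ 0<t              = <⇒≉0 (φ-pos 0<t) φt≈0
    ... | inj₂ (inj₁ t≈0)       = t≉0 t≈0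
    ... | inj₂ (inj₂ t<0)       = <⇒≉0 (φ-pos (x<0⇒0<-x t<0))
      (trans (φ-odd t) (trans (-‿cong φt≈0) -0≈0))

-- Finite sums and maxima

module FiniteSums {ℓ} (em : ExcludedMiddle ℓ) (ℝ : CompleteOrderedField ℓ) where
  open CompleteOrderedField ℝ
  open RealOperations em ℝ
  open OrderedField em ℝ
  open Mult semiring using (×-homo-+)
  open SemiringSum semiring using (sum-remove; sum-replicate-zero; sum-cong-≋)
  open IsTotalOrder isTotalOrder using (total)
    renaming (trans to ≤-trans; refl to ≤-refl; reflexive to ≤-reflexive)
  open PosetReasoning poset

  sum-mono-≤ : ∀ {n} {f g : Fin n → Carrier} → (∀ i → f i ≤ g i) → sum f ≤ sum g
  sum-mono-≤ {ℕ.zero} f≤g = ≤-refl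
  sum-mono-≤ {suc n}  f≤g = +-mono-≤ (f≤g Fin.zero) (sum-mono-≤ (f≤g ∘ Fin.suc))

  sum-zero : ∀ {n} {f : Fin n → Carrier} → (∀ i → f i ≈ 0#) → sum f ≈ 0#
  sum-zero {n} f≈0 = trans (sum-cong-≋ f≈0) (sum-replicate-zero n)

  sum-nonNeg : ∀ {n} {f : Fin n → Carrier} → (∀ i → 0# ≤ f i) → 0# ≤ sum f
  sum-nonNeg {n} 0≤f = ≤-trans (≤-reflexive (sym (sum-replicate-zero n))) (sum-mono-≤ 0≤f)

  term≤sum : ∀ {n} {f : Fin n → Carrier} → (∀ i → 0# ≤ f i) → ∀ i → f i ≤ sum f
  term≤sum {suc n} {f} 0≤f i = ≤-trans (x≤x+y (sum-nonNeg (0≤f ∘ Fin.punchIn i)))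
                                       (≤-reflexive (sym (sum-remove {i = i} f)))

  -- Applied to the rows of the double sum over vertices, where an edge occurs once in the row of
  -- each of its two ends.
  two-terms≤sum : ∀ {n} {f : Fin n → Carrier} → (∀ i → 0# ≤ f i) →
                  ∀ {i j} → ¬ i ≡ j → f i + f j ≤ sum f
  two-terms≤sum {suc n} {f} 0≤f {i} {j} i≢j = begin
    f i + f j                                ≡⟨ ≡.cong (λ k → f i + f k) (Fin.punchIn-punchOut i≢j) ⟨
    f i + f (Fin.punchIn i (Fin.punchOut i≢j))
      ≤⟨ +-mono-≤ ≤-refl (term≤sum (0≤f ∘ Fin.punchIn i) (Fin.punchOut i≢j)) ⟩
    f i + sum (f ∘ Fin.punchIn i)            ≈⟨ sum-remove {i = i} f ⟨
    sum f                                    ∎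

  fromℕ-sum : ∀ {n} (d : Fin n → ℕ) → fromℕ (MonoidSum.sum ℕ.+-0-commutativeMonoid d) ≈ sum (fromℕ ∘ d)
  fromℕ-sum {ℕ.zero} d = refl
  fromℕ-sum {suc n}  d = trans (×-homo-+ 1# (d Fin.zero) _) (+-congˡ (fromℕ-sum (d ∘ Fin.suc)))

  argmax : ∀ {n} (g : Fin (suc n) → Carrier) → ∃ λ i → ∀ j → g j ≤ g i
  argmax {ℕ.zero} g = Fin.zero , λ { Fin.zero → ≤-refl }
  argmax {suc n}  g with argmax (g ∘ Fin.suc)
  ... | i , max with total (g (Fin.suc i)) (g Fin.zero)
  ...   | inj₁ gi≤g0 = Fin.zero , λ { Fin.zero → ≤-refl ; (Fin.suc j) → ≤-trans (max j) gi≤g0 }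
  ...   | inj₂ g0≤gi = Fin.suc i , λ { Fin.zero → g0≤gi ; (Fin.suc j) → max j }

-- Walks, distances and degrees

module Distances {ℓ} (em : ExcludedMiddle ℓ) {n} (G : SignedGraph n) where
  open SignedGraph G

  -- As long as a shorter walk exists it replaces the current one; well-founded descent on the
  -- length stops at a shortest walk.
  walk⇒distance : ∀ {x y k} → Walk k x y → ∃ λ j → IsDistance x y j
  walk⇒distance {x} {y} {k} = go k (<-wellFounded k)
    where
    go : ∀ k → Acc ℕ._<_ k → Walk k x y → ∃ λ j → IsDistance x y j
    go k (acc rs) w with em {Lift ℓ (∃ λ j → j ℕ.< k × Walk j x y)}
    ... | yes (lift (j , j<k , w′)) = go j (rs j<k) w′
    ... | no  none = k , w , λ j w′ → ℕ.≮⇒≥ λ j<k → none (lift (j , j<k , w′))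

  walk-within-diameter : Connected → ∀ {D} → IsDiameter D → ∀ x y → ∃ λ k → k ℕ.≤ D × Walk k x y
  walk-within-diameter connected (_ , distance≤D) x y =
    let (k , dist) = walk⇒distance (proj₂ (connected x y)) in k , distance≤D x y k dist , proj₁ dist

  degree-pos : ∀ {x y} → x ~ y → ¬ degree x ≡ 0
  degree-pos {x} {y} x~y degree≡0 =
    ℕ.n≮0 (≡.subst (∣ neighbours x Subset.- y ∣ ℕ.<_) degree≡0 (x∈p⇒∣p-x∣<∣p∣ (lookup⇒[]= y (neighbours x)
      (≡.trans (lookup∘tabulate _ y) (dec-true (x ~? y) x~y)))))

-- The truncated sign function

module TestFunction {ℓ} (em : ExcludedMiddle ℓ) (ℝ : CompleteOrderedField ℓ) where
  open CompleteOrderedField ℝ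
  open RealOperations em ℝ
  open OrderedField em ℝ
  open SignedPower em ℝ
  open RingProperties ring using (-‿involutive) renaming (-0#≈0# to -0≈0)
  open IntegerCoefficients commutativeRing
    using (solve; :0; :1; _:+_; _:*_; _:-_; :-_; _:=_)
  open IsTotalOrder isTotalOrder using (antisym; total)
    renaming (trans to ≤-trans; refl to ≤-refl; reflexive to ≤-reflexive)
  open PosetReasoning poset

  indicator : Carrier → Carrier → Carrier
  indicator t u = if does (t ≤? u) then 1# else 0#

  indicator-yes : ∀ {t u} → t ≤ u → indicator t u ≈ 1#
  indicator-yes {t} {u} t≤u = reflexive (if-yes (t ≤? u) t≤u)

  indicator-no : ∀ {t u} → ¬ t ≤ u → indicator t u ≈ 0#
  indicator-no {t} {u} t≰u = reflexive (if-no (t ≤? u) t≰u)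

  indicator-bounds : ∀ t u → 0# ≤ indicator t u × indicator t u ≤ 1#
  indicator-bounds t u = by-cases em
    where
    by-cases : Dec (t ≤ u) → 0# ≤ indicator t u × indicator t u ≤ 1#
    by-cases (yes t≤u) = ≤-trans 0≤1 (≤-reflexive (sym (indicator-yes t≤u))) , ≤-reflexive (indicator-yes t≤u)
    by-cases (no  t≰u) = ≤-reflexive (sym (indicator-no t≰u)) , ≤-trans (≤-reflexive (indicator-no t≰u)) 0≤1

  indicator-implication : ∀ {t u v} → (t ≤ u → t ≤ v) → indicator t u ≤ indicator t v
  indicator-implication {t} {u} {v} h = by-cases em
    where
    by-cases : Dec (t ≤ u) → indicator t u ≤ indicator t v
    by-cases (yes t≤u) = ≤-reflexive (trans (indicator-yes t≤u) (sym (indicator-yes (h t≤u))))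
    by-cases (no  t≰u) = ≤-trans (≤-reflexive (indicator-no t≰u)) (proj₁ (indicator-bounds t v))

  -- The sign of u, truncated to 0 on the interval |u| < t.
  H : Carrier → Carrier → Carrier
  H t u = indicator t u - indicator t (- u)

  H-cong-⇔ : ∀ {t u v} → (t ≤ u → t ≤ v) → (t ≤ v → t ≤ u) →
             (t ≤ - u → t ≤ - v) → (t ≤ - v → t ≤ - u) → H t u ≈ H t v
  H-cong-⇔ h₁ h₂ h₃ h₄ =
    +-cong (antisym (indicator-implication h₁) (indicator-implication h₂))
           (-‿cong (antisym (indicator-implication h₃) (indicator-implication h₄)))

  H-cong : ∀ t {u v} → u ≈ v → H t u ≈ H t v
  H-cong t u≈v = H-cong-⇔ (λ h → ≤-trans h (≤-reflexive u≈v)) (λ h → ≤-trans h (≤-reflexive (sym u≈v)))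
    (λ h → ≤-trans h (≤-reflexive (-‿cong u≈v))) (λ h → ≤-trans h (≤-reflexive (-‿cong (sym u≈v))))

  H-odd : ∀ t u → H t (- u) ≈ - H t u
  H-odd t u = begin-equality
    indicator t (- u) - indicator t (- - u)
      ≈⟨ +-congˡ (-‿cong (antisym (indicator-implication λ h → ≤-trans h (≤-reflexive (-‿involutive u)))
                                  (indicator-implication λ h → ≤-trans h (≤-reflexive (sym (-‿involutive u)))))) ⟩
    indicator t (- u) - indicator t u
      ≈⟨ solve 2 (λ a b → b :- a := :- (a :- b)) refl (indicator t u) (indicator t (- u)) ⟩
    - (indicator t u - indicator t (- u))  ∎

  private
    -- For `v ≤ u` both brackets are nonnegative. This gives monotonicity of `H`, and it allows a
    -- single bracket equal to 1 to bound the whole difference from below.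
    H-difference : ∀ t u v → H t u - H t v ≈
      (indicator t u - indicator t v) + (indicator t (- v) - indicator t (- u))
    H-difference t u v = solve 4 (λ a b c d → a :- b :- (c :- d) := (a :- c) :+ (d :- b)) refl
      (indicator t u) (indicator t (- u)) (indicator t v) (indicator t (- v))

    positive-part negative-part : ∀ t {u v} → v ≤ u → Carrier
    positive-part t {u} {v} _ = indicator t u - indicator t v
    negative-part t {u} {v} _ = indicator t (- v) - indicator t (- u)

    0≤positive-part : ∀ t {u v} (v≤u : v ≤ u) → 0# ≤ positive-part t v≤u
    0≤positive-part t v≤u = x≤y⇒0≤y-x (indicator-implication λ t≤v → ≤-trans t≤v v≤u)

    0≤negative-part : ∀ t {u v} (v≤u : v ≤ u) → 0# ≤ negative-part t v≤u
    0≤negative-part t v≤u = x≤y⇒0≤y-x (indicator-implication λ t≤-u → ≤-trans t≤-u (-‿anti-≤ v≤u))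

  H-mono : ∀ t {u v} → v ≤ u → 0# ≤ H t u - H t v
  H-mono t {u} {v} v≤u = ≤-trans (+-nonNeg (0≤positive-part t v≤u) (0≤negative-part t v≤u))
                                 (≤-reflexive (sym (H-difference t u v)))

  x≤0⇒¬0<x+x : ∀ {x} → x ≤ 0# → ¬ 0# < x + x
  x≤0⇒¬0<x+x x≤0 0<x+x = <⇒≱ 0<x+x (≤-trans (+-mono-≤ x≤0 x≤0) (≤-reflexive (+-identityʳ 0#)))

  -- The witness is the larger of u and - v.
  separating-threshold : ∀ {u v} → v < u → ∃ λ t → 0# < t × 1# ≤ H t u - H t v
  separating-threshold {u} {v} v<u = [ take-v , take-u ]′ (total u (- v))
    where
    v≤u = proj₁ v<u
    take-u : - v ≤ u → ∃ λ t → 0# < t × 1# ≤ H t u - H t v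
    -- From 0 < u - v ≤ u + u the threshold `u` is positive; `u` attains it and `v` does not.
    take-u -v≤u = u , ≰⇒> (λ u≤0 → x≤0⇒¬0<x+x u≤0 (0<-≤-trans (x<y⇒0<y-x v<u) (+-mono-≤ ≤-refl -v≤u)))
      , (begin
        1#               ≈⟨ solve 0 (:1 := :1 :- :0) refl ⟩
        1# - 0#          ≈⟨ +-cong (indicator-yes ≤-refl) (-‿cong (indicator-no (<⇒≱ v<u))) ⟨
        positive-part u v≤u                            ≤⟨ x≤x+y (0≤negative-part u v≤u) ⟩
        positive-part u v≤u + negative-part u v≤u      ≈⟨ H-difference u u v ⟨
        H u u - H u v    ∎)
    take-v : u ≤ - v → ∃ λ t → 0# < t × 1# ≤ H t u - H t v
    take-v u≤-v = - v , ≰⇒> (λ -v≤0 → x≤0⇒¬0<x+x -v≤0 (0<-≤-trans (x<y⇒0<y-x v<u) (+-mono-≤ u≤-v ≤-refl)))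
      , (begin
        1#               ≈⟨ solve 0 (:1 := :1 :- :0) refl ⟩
        1# - 0#          ≈⟨ +-cong (indicator-yes ≤-refl) (-‿cong (indicator-no λ -v≤-u → <⇒≱ v<u
                              (≤-trans (≤-reflexive (sym (-‿involutive u)))
                                (≤-trans (-‿anti-≤ -v≤-u) (≤-reflexive (-‿involutive v)))))) ⟨
        negative-part (- v) v≤u                              ≤⟨ x≤x+y (0≤positive-part (- v) v≤u) ⟩
        negative-part (- v) v≤u + positive-part (- v) v≤u    ≈⟨ +-comm _ _ ⟩
        positive-part (- v) v≤u + negative-part (- v) v≤u    ≈⟨ H-difference (- v) u v ⟨
        H (- v) u - H (- v) v    ∎)

  ⟦⟧-square : ∀ s x → ⟦ s ⟧ * (⟦ s ⟧ * x) ≈ x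
  ⟦⟧-square Sign.+ x = solve 1 (λ x → :1 :* (:1 :* x) := x) refl x
  ⟦⟧-square Sign.- x = solve 1 (λ x → :- :1 :* (:- :1 :* x) := x) refl x

  odd-⟦⟧ : ∀ (F : Carrier → Carrier) → (∀ {u v} → u ≈ v → F u ≈ F v) → (∀ u → F (- u) ≈ - F u) →
           ∀ s u → F (⟦ s ⟧ * u) ≈ ⟦ s ⟧ * F u
  odd-⟦⟧ F F-cong F-odd Sign.+ u = trans (F-cong (*-identityˡ u)) (sym (*-identityˡ _))
  odd-⟦⟧ F F-cong F-odd Sign.- u = begin-equality
    F (- 1# * u)  ≈⟨ F-cong (solve 1 (λ u → :- :1 :* u := :- u) refl u) ⟩
    F (- u)       ≈⟨ F-odd u ⟩
    - F u         ≈⟨ solve 1 (λ u → :- u := :- :1 :* u) refl (F u) ⟩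
    - 1# * F u    ∎

  abs-⟦⟧ : ∀ s u → abs (⟦ s ⟧ * u) ≈ abs u
  abs-⟦⟧ Sign.+ u = abs-cong (*-identityˡ u)
  abs-⟦⟧ Sign.- u = trans (abs-cong (solve 1 (λ u → :- :1 :* u := :- u) refl u))
    (antisym (abs-least (-x≤abs u) (≤-trans (≤-reflexive (-‿involutive u)) (x≤abs u)))
             (abs-least (≤-trans (≤-reflexive (sym (-‿involutive u))) (-x≤abs (- u))) (x≤abs (- u))))

  -- If `t ≤ u` while `v ≤ 0`, then u - v ≥ t, against nearness. So outside the gap of radius `t`
  -- around 0, a step shorter than `t` cannot change sides.
  H-cong-near : ∀ {t u v} → 0# < t → t ≤ abs u → t ≤ abs v → abs (u - v) < t → H t u ≈ H t v
  H-cong-near {t} {u} {v} 0<t t≤∣u∣ t≤∣v∣ near = H-cong-⇔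
    (same-side t≤∣v∣ (≤-<′ (x≤abs _)))
    (same-side t≤∣u∣ (≤-<′ (≤-trans (≤-reflexive (solve 2 (λ u v → v :- u := :- (u :- v)) refl u v)) (-x≤abs _))))
    (same-side (≤-trans t≤∣v∣ (≤-reflexive (abs-neg-≈ v)))
      (≤-<′ (≤-trans (≤-reflexive (solve 2 (λ u v → :- u :- :- v := :- (u :- v)) refl u v)) (-x≤abs _))))
    (same-side (≤-trans t≤∣u∣ (≤-reflexive (abs-neg-≈ u)))
      (≤-<′ (≤-trans (≤-reflexive (solve 2 (λ u v → :- v :- :- u := u :- v) refl u v)) (x≤abs _))))
    where
    abs-neg-≈ : ∀ x → abs x ≈ abs (- x)
    abs-neg-≈ x = trans (sym (abs-⟦⟧ Sign.- x)) (abs-cong (solve 1 (λ x → :- :1 :* x := :- x) refl x))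
    ≤-<′ : ∀ {z} → z ≤ abs (u - v) → z < t
    ≤-<′ {z} z≤ = begin-strict z ≤⟨ z≤ ⟩ abs (u - v) <⟨ near ⟩ t ∎
    same-side : ∀ {u v} → t ≤ abs v → u - v < t → t ≤ u → t ≤ v
    same-side {u} {v} t≤∣v∣ u-v<t t≤u with abs-cases v
    ... | inj₁ (_ , eq)    = ≤-trans t≤∣v∣ (≤-reflexive (reflexive eq))
    ... | inj₂ (0≤-v , _)  = contradiction (≤-trans t≤u (x≤x+y 0≤-v)) (<⇒≱ u-v<t)

  -- The energy of an edge and the weight of a vertex

  module _ {p : Carrier} (1<p : 1# < p) where

    edgeEnergy : Carrier → Carrier → Carrier → Carrier
    edgeEnergy t u v = (H t u - H t v) * φ p (u - v)

    edgeEnergy-sym : ∀ t u v → edgeEnergy t u v ≈ edgeEnergy t v u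
    edgeEnergy-sym t u v = begin-equality
      (H t u - H t v) * φ p (u - v)
        ≈⟨ *-congˡ (φ-cong 1<p (solve 2 (λ u v → u :- v := :- (v :- u)) refl u v)) ⟩
      (H t u - H t v) * φ p (- (v - u))   ≈⟨ *-congˡ (φ-odd 1<p (v - u)) ⟩
      (H t u - H t v) * - φ p (v - u)
        ≈⟨ solve 3 (λ x y z → (x :- y) :* :- z := (y :- x) :* z) refl (H t u) (H t v) (φ p (v - u)) ⟩
      (H t v - H t u) * φ p (v - u)       ∎

    edgeEnergy-nonNeg : ∀ t u v → 0# ≤ edgeEnergy t u v
    edgeEnergy-nonNeg t u v = [ (λ u≤v → ≤-trans (ordered u≤v) (≤-reflexive (edgeEnergy-sym t v u))) , ordered ]′ (total u v)
      where
      ordered : ∀ {u v} → v ≤ u → 0# ≤ edgeEnergy t u v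
      ordered v≤u = *-nonNeg (H-mono t v≤u) (φ-nonNeg 1<p (x≤y⇒0≤y-x v≤u))

    private
      edgeEnergy-large-ordered : ∀ {δ u v} → 0# < δ → δ ≤ u - v → ∃ λ t → 0# < t × φ p δ ≤ edgeEnergy t u v
      edgeEnergy-large-ordered {δ} {u} {v} 0<δ δ≤u-v = t , proj₁ (proj₂ separated) , (begin
        φ p δ            ≤⟨ φ-mono-pos 1<p 0<δ δ≤u-v ⟩
        φ p (u - v)      ≈⟨ *-identityˡ _ ⟨
        1# * φ p (u - v) ≤⟨ *-monoˡ-≤ (φ-nonNeg 1<p (≤-trans (proj₁ 0<δ) δ≤u-v)) (proj₂ (proj₂ separated)) ⟩
        edgeEnergy t u v          ∎)
        where
        v<u : v < u
        v<u = ≰⇒> λ u≤v → <⇒≱ 0<δ (≤-trans δ≤u-v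
                (≤-trans (+-mono-≤ u≤v ≤-refl) (≤-reflexive (-‿inverseʳ v))))
        separated : ∃ λ t → 0# < t × 1# ≤ H t u - H t v
        separated = separating-threshold v<u
        t : Carrier
        t = proj₁ separated

    -- The threshold is adapted to this one edge so that `H` jumps by at least 1 across it; every
    -- other edge will contribute a nonnegative amount at the same threshold.
    edgeEnergy-large : ∀ {δ u v} → 0# < δ → δ ≤ abs (u - v) → ∃ λ t → 0# < t × φ p δ ≤ edgeEnergy t u v
    edgeEnergy-large {δ} {u} {v} 0<δ δ≤∣u-v∣ with abs-cases (u - v)
    ... | inj₁ (_ , eq) = edgeEnergy-large-ordered 0<δ (≤-trans δ≤∣u-v∣ (≤-reflexive (reflexive eq)))
    ... | inj₂ (_ , eq) = let (t , 0<t , φδ≤T) = edgeEnergy-large-ordered 0<δ (≤-trans δ≤∣u-v∣ (≤-reflexive (trans (reflexive eq)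
                                (solve 2 (λ u v → :- (u :- v) := v :- u) refl u v))))
                          in t , 0<t , ≤-trans φδ≤T (≤-reflexive (edgeEnergy-sym t v u))

    -- Both H and φ are odd, so this is H t u * φ p u.
    Hφ : Carrier → Carrier → Carrier
    Hφ t u = H t (abs u) * φ p (abs u)

    Hφ≈ : ∀ t u → H t u * φ p u ≈ Hφ t u
    Hφ≈ t u with abs-cases u
    ... | inj₁ (_ , eq) = *-cong (H-cong t (reflexive (≡.sym eq))) (φ-cong 1<p (reflexive (≡.sym eq)))
    ... | inj₂ (_ , eq) = begin-equality
      H t u * φ p u            ≈⟨ solve 2 (λ x y → x :* y := :- x :* :- y) refl (H t u) (φ p u) ⟩
      - H t u * - φ p u        ≈⟨ *-cong (H-odd t u) (φ-odd 1<p u) ⟨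
      H t (- u) * φ p (- u)
        ≈⟨ *-cong (H-cong t (reflexive (≡.sym eq))) (φ-cong 1<p (reflexive (≡.sym eq))) ⟩
      Hφ t u                   ∎

    private
      H-of-pos : ∀ {t u} → 0# < t → 0# ≤ u → H t u ≈ indicator t u
      H-of-pos {t} {u} 0<t 0≤u = begin-equality
        indicator t u - indicator t (- u)  ≈⟨ +-congˡ (-‿cong (indicator-no λ t≤-u → <⇒≱ 0<t
          (≤-trans t≤-u (≤-trans (-‿anti-≤ 0≤u) (≤-reflexive -0≈0))))) ⟩
        indicator t u - 0#                 ≈⟨ solve 1 (λ x → x :- :0 := x) refl (indicator t u) ⟩
        indicator t u                      ∎

      φ-mono-nonNeg : ∀ {s t} → 0# ≤ s → s ≤ t → φ p s ≤ φ p t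
      φ-mono-nonNeg {s} {t} 0≤s s≤t = by-cases em
        where
        by-cases : Dec (s ≈ 0#) → φ p s ≤ φ p t
        by-cases (yes s≈0) = ≤-trans (≤-reflexive (φ-zero 1<p s≈0)) (φ-nonNeg 1<p (≤-trans 0≤s s≤t))
        by-cases (no  s≉0) = φ-mono-pos 1<p (0≤s , s≉0 ∘ sym) s≤t

    Hφ-nonNeg : ∀ {t u} → 0# < t → 0# ≤ Hφ t u
    Hφ-nonNeg {t} {u} 0<t = *-nonNeg
      (≤-trans (proj₁ (indicator-bounds t (abs u))) (≤-reflexive (sym (H-of-pos 0<t (0≤abs u)))))
      (φ-nonNeg 1<p (0≤abs u))

    Hφ-upper : ∀ {t u M} → 0# < t → abs u ≤ M → Hφ t u ≤ φ p M
    Hφ-upper {t} {u} {M} 0<t ∣u∣≤M = begin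
      H t (abs u) * φ p (abs u)    ≤⟨ *-monoˡ-≤ (φ-nonNeg 1<p (0≤abs u))
                                        (≤-trans (≤-reflexive (H-of-pos 0<t (0≤abs u))) (proj₂ (indicator-bounds t (abs u)))) ⟩
      1# * φ p (abs u)             ≈⟨ *-identityˡ _ ⟩
      φ p (abs u)                  ≤⟨ φ-mono-nonNeg (0≤abs u) ∣u∣≤M ⟩
      φ p M                        ∎

    Hφ-lower : ∀ {t u} → 0# < t → t ≤ abs u → φ p t ≤ Hφ t u
    Hφ-lower {t} {u} 0<t t≤∣u∣ = begin
      φ p t                        ≤⟨ φ-mono-pos 1<p 0<t t≤∣u∣ ⟩
      φ p (abs u)                  ≈⟨ *-identityˡ _ ⟨
      1# * φ p (abs u)             ≈⟨ *-congʳ (trans (H-of-pos 0<t (0≤abs u)) (indicator-yes t≤∣u∣)) ⟨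
      H t (abs u) * φ p (abs u)    ∎

-- Pairing the eigenvalue equation with the test function

module Eigenfunctions {ℓ} (em : ExcludedMiddle ℓ) (ℝ : CompleteOrderedField ℓ)
                      {n} (G : SignedGraph n) where
  open CompleteOrderedField ℝ
  open RealOperations em ℝ
  open SignedGraph G
  open PLaplacian em ℝ G
  open OrderedField em ℝ
  open SignedPower em ℝ
  open FiniteSums em ℝ
  open Distances em G
  open TestFunction em ℝ
  open RingProperties ring using () renaming (-0#≈0# to -0≈0)
  open IntegerCoefficients commutativeRing
    using (solve; :0; :1; _:+_; _:*_; _:-_; :-_; _:=_)
  open SemiringSum semiring using (sum-cong-≋; ∑-distrib-+; ∑-comm; *-distribˡ-sum)
  open IsTotalOrder isTotalOrder using ()
    renaming (trans to ≤-trans; refl to ≤-refl; reflexive to ≤-reflexive)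
  open PosetReasoning poset

  module _ {p : Carrier} (1<p : 1# < p) {μ : Carrier} {f : Fin n → Carrier}
           (eigen : ∀ x → - Δ p f x ≈ μ * φ p (f x)) where

    private
      d : Fin n → Carrier
      d x = fromℕ (degree x)

      S : Fin n → Carrier
      S x = sum λ y → if does (x ~? y) then φ p (⟦ σ x y ⟧ * f y - f x) else 0#

      S-isolated : ∀ x → degree x ≡ 0 → S x ≈ 0#
      S-isolated x degree≡0 = sum-zero λ y →
        reflexive (if-no (x ~? y) λ x~y → degree-pos x~y degree≡0)

    0<degree : ∀ x → ¬ degree x ≡ 0 → 0# < fromℕ (degree x)
    0<degree x degree≢0 = 0<-≤-trans 0<1
      (≤-trans (≤-reflexive (sym (+-identityʳ 1#))) (fromℕ-mono-≤ (ℕ.n≢0⇒n>0 degree≢0)))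

    -- Clears the division by the degree. At an isolated vertex both sides vanish: the sum on the
    -- left is empty of neighbours and the right side has the factor 0.
    degree-eigen : ∀ x → - S x ≈ d x * (μ * φ p (f x))
    degree-eigen x = by-cases (degree x ℕ.≟ 0)
      where
      by-cases : Dec (degree x ≡ 0) → - S x ≈ d x * (μ * φ p (f x))
      by-cases (yes degree≡0) = begin-equality
        - S x                     ≈⟨ -‿cong (S-isolated x degree≡0) ⟩
        - 0#                      ≈⟨ -0≈0 ⟩
        0#                        ≈⟨ zeroˡ _ ⟨
        0# * (μ * φ p (f x))      ≡⟨ ≡.cong (λ k → fromℕ k * (μ * φ p (f x))) degree≡0 ⟨
        d x * (μ * φ p (f x))     ∎
      by-cases (no degree≢0) = begin-equality
        - S x                     ≈⟨ -‿cong (*-identityˡ _) ⟨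
        - (1# * S x)              ≈⟨ -‿cong (*-congʳ (⁻¹-inverseʳ (<⇒≉0 (0<degree x degree≢0)))) ⟨
        - (d x * d x ⁻¹ * S x)
          ≈⟨ solve 3 (λ x y z → :- (x :* y :* z) := x :* :- (y :* z)) refl (d x) (d x ⁻¹) (S x) ⟩
        d x * - (d x ⁻¹ * S x)    ≈⟨ *-congˡ (eigen x) ⟩
        d x * (μ * φ p (f x))     ∎

    -- At a vertex without neighbours Δ f = 0, by the convention 0 ⁻¹ = 0.
    nonzero⇒degree≢0 : ¬ μ ≈ 0# → ∀ {x} → ¬ f x ≈ 0# → ¬ degree x ≡ 0
    nonzero⇒degree≢0 μ≉0 {x} fx≉0 degree≡0 = μ≉0 (*-cancelʳ-≈0 (φ-nonzero 1<p fx≉0) (begin-equality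
      μ * φ p (f x)         ≈⟨ eigen x ⟨
      - (d x ⁻¹ * S x)      ≈⟨ -‿cong (*-congˡ (S-isolated x degree≡0)) ⟩
      - (d x ⁻¹ * 0#)       ≈⟨ solve 1 (λ x → :- (x :* :0) := :0) refl (d x ⁻¹) ⟩
      0#                    ∎))

    mass : Carrier → Carrier
    mass t = sum λ x → fromℕ (degree x) * Hφ 1<p t (f x)

    edgeTerm : Carrier → Fin n → Fin n → Carrier
    edgeTerm t x y = if does (x ~? y) then edgeEnergy 1<p t (f x) (⟦ σ x y ⟧ * f y) else 0#

    private
      -- The share of one orientation of an edge in the pairing. A single share may have either
      -- sign; the two orientations together form an edge energy.
      arc : Carrier → Fin n → Fin n → Carrier
      arc t x y = if does (x ~? y) then H t (f x) * φ p (f x - ⟦ σ x y ⟧ * f y) else 0#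

      arc-row : ∀ t x → H t (f x) * - S x ≈ sum (arc t x)
      arc-row t x = begin-equality
        H t (f x) * - S x
          ≈⟨ solve 2 (λ x y → x :* :- y := :- x :* y) refl (H t (f x)) (S x) ⟩
        - H t (f x) * S x
          ≈⟨ *-distribˡ-sum (- H t (f x)) (λ y → if does (x ~? y) then φ p (⟦ σ x y ⟧ * f y - f x) else 0#) ⟩
        sum (λ y → - H t (f x) * (if does (x ~? y) then φ p (⟦ σ x y ⟧ * f y - f x) else 0#))
          ≈⟨ sum-cong-≋ (λ y → termwise y (x ~? y)) ⟩
        sum (arc t x)  ∎
        where
        termwise : ∀ y {a} {A : Set a} (dec : Dec A) →
                   - H t (f x) * (if does dec then φ p (⟦ σ x y ⟧ * f y - f x) else 0#)
                   ≈ (if does dec then H t (f x) * φ p (f x - ⟦ σ x y ⟧ * f y) else 0#)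
        termwise y (no _)  = zeroʳ _
        termwise y (yes _) = begin-equality
          - H t (f x) * φ p (⟦ σ x y ⟧ * f y - f x)
            ≈⟨ *-congˡ (φ-cong 1<p (solve 2 (λ u v → v :- u := :- (u :- v)) refl (f x) (⟦ σ x y ⟧ * f y))) ⟩
          - H t (f x) * φ p (- (f x - ⟦ σ x y ⟧ * f y))
            ≈⟨ *-congˡ (φ-odd 1<p _) ⟩
          - H t (f x) * - φ p (f x - ⟦ σ x y ⟧ * f y)
            ≈⟨ solve 2 (λ x y → :- x :* :- y := x :* y) refl (H t (f x)) (φ p (f x - ⟦ σ x y ⟧ * f y)) ⟩
          H t (f x) * φ p (f x - ⟦ σ x y ⟧ * f y)  ∎

      -- As s² = 1, w - s u = -s (u - s w). Oddness of φ extracts the factor -s, and oddness of `H`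
      -- absorbs s into its argument, so a signed edge behaves like an unsigned one between `u` and
      -- s w.
      edge-identity : ∀ t s u w → H t u * φ p (u - ⟦ s ⟧ * w) + H t w * φ p (w - ⟦ s ⟧ * u)
                                  ≈ edgeEnergy 1<p t u (⟦ s ⟧ * w)
      edge-identity t s u w = begin-equality
        H t u * φ p v + H t w * φ p (w - ⟦ s ⟧ * u)
          ≈⟨ +-congˡ (*-congˡ (φ-cong 1<p w-su≈-sv)) ⟩
        H t u * φ p v + H t w * φ p (- (⟦ s ⟧ * v))
          ≈⟨ +-congˡ (*-congˡ (trans (φ-odd 1<p _) (-‿cong (odd-⟦⟧ (φ p) (φ-cong 1<p) (φ-odd 1<p) s v)))) ⟩
        H t u * φ p v + H t w * - (⟦ s ⟧ * φ p v)
          ≈⟨ solve 4 (λ a b c s → a :* b :+ c :* :- (s :* b) := (a :- s :* c) :* b) refl (H t u) (φ p v) (H t w) ⟦ s ⟧ ⟩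
        (H t u - ⟦ s ⟧ * H t w) * φ p v
          ≈⟨ *-congʳ (+-congˡ (-‿cong (odd-⟦⟧ (H t) (H-cong t) (H-odd t) s w))) ⟨
        edgeEnergy 1<p t u (⟦ s ⟧ * w)  ∎
        where
        v : Carrier
        v = u - ⟦ s ⟧ * w
        w-su≈-sv : w - ⟦ s ⟧ * u ≈ - (⟦ s ⟧ * v)
        w-su≈-sv = begin-equality
          w - ⟦ s ⟧ * u                       ≈⟨ +-congʳ (⟦⟧-square s w) ⟨
          ⟦ s ⟧ * (⟦ s ⟧ * w) - ⟦ s ⟧ * u
            ≈⟨ solve 3 (λ s u w → s :* w :- s :* u := :- (s :* (u :- w))) refl ⟦ s ⟧ u (⟦ s ⟧ * w) ⟩
          - (⟦ s ⟧ * v)                       ∎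

      arc-pair : ∀ t x y → arc t x y + arc t y x ≈ edgeTerm t x y
      arc-pair t x y = by-cases (x ~? y)
        where
        by-cases : Dec (x ~ y) → arc t x y + arc t y x ≈ edgeTerm t x y
        by-cases (yes x~y) = begin-equality
          arc t x y + arc t y x
            ≡⟨ ≡.cong₂ _+_ (if-yes (x ~? y) x~y) (if-yes (y ~? x) (~-sym x~y)) ⟩
          H t (f x) * φ p (f x - ⟦ σ x y ⟧ * f y) + H t (f y) * φ p (f y - ⟦ σ y x ⟧ * f x)
            ≡⟨ ≡.cong (λ s → H t (f x) * φ p (f x - ⟦ σ x y ⟧ * f y) + H t (f y) * φ p (f y - ⟦ s ⟧ * f x))
                 (σ-sym x~y) ⟨
          H t (f x) * φ p (f x - ⟦ σ x y ⟧ * f y) + H t (f y) * φ p (f y - ⟦ σ x y ⟧ * f x)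
            ≈⟨ edge-identity t (σ x y) (f x) (f y) ⟩
          edgeEnergy 1<p t (f x) (⟦ σ x y ⟧ * f y)
            ≡⟨ if-yes (x ~? y) x~y ⟨
          edgeTerm t x y  ∎
        by-cases (no x≁y) = begin-equality
          arc t x y + arc t y x    ≡⟨ ≡.cong₂ _+_ (if-no (x ~? y) x≁y) (if-no (y ~? x) (x≁y ∘ ~-sym)) ⟩
          0# + 0#                  ≈⟨ +-identityʳ 0# ⟩
          0#                       ≡⟨ if-no (x ~? y) x≁y ⟨
          edgeTerm t x y           ∎

      μ-mass : ∀ t → μ * mass t ≈ sum (λ x → sum (arc t x))
      μ-mass t = begin-equality
        μ * mass t
          ≈⟨ *-distribˡ-sum μ (λ x → d x * Hφ 1<p t (f x)) ⟩
        sum (λ x → μ * (d x * Hφ 1<p t (f x)))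
          ≈⟨ sum-cong-≋ (λ x → begin-equality
               μ * (d x * Hφ 1<p t (f x))             ≈⟨ *-congˡ (*-congˡ (Hφ≈ 1<p t (f x))) ⟨
               μ * (d x * (H t (f x) * φ p (f x)))
                 ≈⟨ solve 4 (λ m d h f → m :* (d :* (h :* f)) := h :* (d :* (m :* f))) refl μ (d x) (H t (f x)) (φ p (f x)) ⟩
               H t (f x) * (d x * (μ * φ p (f x)))    ≈⟨ *-congˡ (degree-eigen x) ⟨
               H t (f x) * - S x                      ≈⟨ arc-row t x ⟩
               sum (arc t x)                          ∎) ⟩
        sum (λ x → sum (arc t x))  ∎

    edgeTerm-sym : ∀ t x y → edgeTerm t x y ≈ edgeTerm t y x
    edgeTerm-sym t x y = trans (sym (arc-pair t x y)) (trans (+-comm _ _) (arc-pair t y x))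

    -- Summation by parts. The double sum runs over ordered pairs and meets every edge twice, which
    -- the doubled left side matches.
    energy : ∀ t → μ * mass t + μ * mass t ≈ sum (λ x → sum (edgeTerm t x))
    energy t = begin-equality
      μ * mass t + μ * mass t
        ≈⟨ +-cong (μ-mass t) (trans (μ-mass t) (∑-comm (arc t))) ⟩
      sum (λ x → sum (arc t x)) + sum (λ x → sum (λ y → arc t y x))
        ≈⟨ ∑-distrib-+ (λ x → sum (arc t x)) (λ x → sum (λ y → arc t y x)) ⟨
      sum (λ x → sum (arc t x) + sum (λ y → arc t y x))
        ≈⟨ sum-cong-≋ (λ x → trans (sym (∑-distrib-+ (arc t x) (λ y → arc t y x))) (sum-cong-≋ (arc-pair t x))) ⟩
      sum (λ x → sum (edgeTerm t x))  ∎

    edgeTerm-nonNeg : ∀ t x y → 0# ≤ edgeTerm t x y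
    edgeTerm-nonNeg t x y = nonNeg (x ~? y)
      where
      nonNeg : ∀ {a} {A : Set a} (dec : Dec A) →
               0# ≤ (if does dec then edgeEnergy 1<p t (f x) (⟦ σ x y ⟧ * f y) else 0#)
      nonNeg (yes _) = edgeEnergy-nonNeg 1<p t _ _
      nonNeg (no _)  = ≤-refl

    mass-nonNeg : ∀ {t} → 0# < t → 0# ≤ mass t
    mass-nonNeg 0<t = sum-nonNeg λ x → *-nonNeg (0≤fromℕ (degree x)) (Hφ-nonNeg 1<p 0<t)

    mass-upper : ∀ {t M} → 0# < t → (∀ x → abs (f x) ≤ M) → mass t ≤ fromℕ vol * φ p M
    mass-upper {t} {M} 0<t ∣f∣≤M = begin
      mass t                            ≤⟨ sum-mono-≤ (λ x → *-monoʳ-≤ (0≤fromℕ (degree x)) (Hφ-upper 1<p 0<t (∣f∣≤M x))) ⟩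
      sum (λ x → d x * φ p M)           ≈⟨ sum-cong-≋ (λ x → *-comm (d x) (φ p M)) ⟩
      sum (λ x → φ p M * d x)           ≈⟨ *-distribˡ-sum (φ p M) d ⟨
      φ p M * sum d                     ≈⟨ *-congˡ (fromℕ-sum degree) ⟨
      φ p M * fromℕ vol                 ≈⟨ *-comm _ _ ⟩
      fromℕ vol * φ p M                 ∎

    steep-edge-bound : ∀ {δ M x y} → 0# < δ → (∀ z → abs (f z) ≤ M) →
      x ~ y → δ ≤ abs (f x - ⟦ σ x y ⟧ * f y) → 0# ≤ μ × φ p δ ≤ μ * (fromℕ vol * φ p M)
    steep-edge-bound {δ} {M} {x} {y} 0<δ ∣f∣≤M x~y steep =
      0≤μ , ≤-trans φδ≤μ*mass (*-monoʳ-≤ 0≤μ (mass-upper 0<t ∣f∣≤M))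
      where
      large : ∃ λ t → 0# < t × φ p δ ≤ edgeEnergy 1<p t (f x) (⟦ σ x y ⟧ * f y)
      large = edgeEnergy-large 1<p 0<δ steep
      t : Carrier
      t = proj₁ large
      0<t : 0# < t
      0<t = proj₁ (proj₂ large)
      row : Fin n → Carrier
      row z = sum (edgeTerm t z)
      φδ≤edgeTerm : φ p δ ≤ edgeTerm t x y
      φδ≤edgeTerm = ≤-trans (proj₂ (proj₂ large)) (≤-reflexive (reflexive (≡.sym (if-yes (x ~? y) x~y))))
      -- The steep edge is counted in both orientations, so the factor 2 of `energy` is not lost.
      doubled : φ p δ + φ p δ ≤ μ * mass t + μ * mass t
      doubled = begin
        φ p δ + φ p δ                      ≤⟨ +-mono-≤ φδ≤edgeTerm (≤-trans φδ≤edgeTerm (≤-reflexive (edgeTerm-sym t x y))) ⟩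
        edgeTerm t x y + edgeTerm t y x    ≤⟨ +-mono-≤ (term≤sum (edgeTerm-nonNeg t x) y) (term≤sum (edgeTerm-nonNeg t y) x) ⟩
        row x + row y                      ≤⟨ two-terms≤sum (λ z → sum-nonNeg (edgeTerm-nonNeg t z)) (λ x≡y → ~-irrefl x≡y x~y) ⟩
        sum row                            ≈⟨ energy t ⟨
        μ * mass t + μ * mass t            ∎
      φδ≤μ*mass : φ p δ ≤ μ * mass t
      φδ≤μ*mass = *-cancelʳ-≤ {z = 2#} (0<-≤-trans 0<1 (x≤x+y 0≤1)) (begin
        φ p δ * 2#                 ≈⟨ solve 1 (λ x → x :* (:1 :+ :1) := x :+ x) refl (φ p δ) ⟩
        φ p δ + φ p δ              ≤⟨ doubled ⟩
        μ * mass t + μ * mass t    ≈⟨ solve 1 (λ x → x :+ x := x :* (:1 :+ :1)) refl (μ * mass t) ⟩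
        μ * mass t * 2#            ∎)
      -- The sign of `μ` is needed before the mass may be replaced by its upper bound. It follows
      -- from 0 < φ(δ) ≤ μ · mass with nonnegative mass.
      0≤μ : 0# ≤ μ
      0≤μ = [ (λ μ≤0 → contradiction (begin
                φ p δ         ≤⟨ φδ≤μ*mass ⟩
                μ * mass t    ≤⟨ *-monoˡ-≤ (mass-nonNeg 0<t) μ≤0 ⟩
                0# * mass t   ≈⟨ zeroˡ _ ⟩
                0#            ∎) (<⇒≱ (φ-pos 1<p 0<δ)))
            , proj₁ ]′ (≤∨> μ 0#)

    -- H δ ∘ f would be compatible with all edges, so its energy would vanish.
    not-flat : ∀ {δ} → ¬ μ ≈ 0# → 0# < δ → (∀ x → δ ≤ abs (f x)) → Fin n →
      ¬ (∀ {x y} → x ~ y → abs (f x - ⟦ σ x y ⟧ * f y) < δ)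
    not-flat {δ} μ≉0 0<δ δ≤∣f∣ x₀ flat = <⇒≱ 0<mass (≤-reflexive mass≈0)
      where
      edgeTerm≈0 : ∀ x y → edgeTerm δ x y ≈ 0#
      edgeTerm≈0 x y = vanishes (x ~? y)
        where
        vanishes : (dec : Dec (x ~ y)) → (if does dec then edgeEnergy 1<p δ (f x) (⟦ σ x y ⟧ * f y) else 0#) ≈ 0#
        vanishes (no _)    = refl
        vanishes (yes x~y) = begin-equality
          (H δ u - H δ v) * φ p (u - v)    ≈⟨ *-congʳ (+-congʳ (H-cong-near 0<δ (δ≤∣f∣ x)
                                                (≤-trans (δ≤∣f∣ y) (≤-reflexive (sym (abs-⟦⟧ (σ x y) (f y))))) (flat x~y))) ⟩
          (H δ v - H δ v) * φ p (u - v)    ≈⟨ solve 2 (λ h z → (h :- h) :* z := :0) refl (H δ v) (φ p (u - v)) ⟩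
          0#                               ∎
          where
          u v : Carrier
          u = f x
          v = ⟦ σ x y ⟧ * f y
      mass≈0 : mass δ ≈ 0#
      mass≈0 = *-cancelʳ-≈0 μ≉0 (*-cancelʳ-≈0 {y = 2#} (<⇒≉0 (0<-≤-trans 0<1 (x≤x+y 0≤1))) (begin-equality
        mass δ * μ * 2#            ≈⟨ solve 2 (λ m x → x :* m :* (:1 :+ :1) := m :* x :+ m :* x) refl μ (mass δ) ⟩
        μ * mass δ + μ * mass δ    ≈⟨ energy δ ⟩
        sum (λ x → sum (edgeTerm δ x))  ≈⟨ sum-zero (λ x → sum-zero (edgeTerm≈0 x)) ⟩
        0#                         ∎))
      f≉0 : ¬ f x₀ ≈ 0#
      f≉0 fx≈0 = <⇒≱ 0<δ (≤-trans (δ≤∣f∣ x₀) (≤-reflexive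
        (trans (abs-cong fx≈0) (reflexive (abs-nonNeg ≤-refl)))))
      0<mass : 0# < mass δ
      0<mass = 0<-≤-trans
        (*-pos (0<degree x₀ (nonzero⇒degree≢0 μ≉0 f≉0)) (0<-≤-trans (φ-pos 1<p 0<δ) (Hφ-lower 1<p 0<δ (δ≤∣f∣ x₀))))
        (term≤sum (λ x → *-nonNeg (0≤fromℕ (degree x)) (Hφ-nonNeg 1<p 0<δ)) x₀)

  -- Multiplication by a sign preserves the modulus, so by the triangle inequality `|f|` changes by
  -- less than δ along an edge, whatever the sign of the edge.
  flat-walk : ∀ {f : Fin n → Carrier} {δ} →
    (∀ {x y} → x ~ y → abs (f x - ⟦ σ x y ⟧ * f y) < δ) →
    ∀ {k x y} → Walk k x y → abs (f x) ≤ abs (f y) + fromℕ k * δ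
  flat-walk flat [] = ≤-difference (≤-refl {0#}) (solve 2 (λ x δ → x :+ :0 :* δ := x :+ :0) refl _ _)
  flat-walk {f} {δ} flat {suc k} {x} {z} (_∷_ {y = y} x~y walk) = begin
    abs (f x)                           ≈⟨ abs-cong (solve 2 (λ u v → u := u :- v :+ v) refl (f x) v) ⟩
    abs (f x - v + v)                   ≤⟨ abs-+ (f x - v) v ⟩
    abs (f x - v) + abs v               ≤⟨ +-mono-≤ (proj₁ (flat x~y)) (≤-reflexive (abs-⟦⟧ (σ x y) (f y))) ⟩
    δ + abs (f y)                       ≤⟨ +-mono-≤ ≤-refl (flat-walk flat walk) ⟩
    δ + (abs (f z) + fromℕ k * δ)
      ≈⟨ solve 3 (λ δ a k → δ :+ (a :+ k :* δ) := a :+ (:1 :+ k) :* δ) refl δ (abs (f z)) (fromℕ k) ⟩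
    abs (f z) + (1# + fromℕ k) * δ      ∎
    where
    v : Carrier
    v = ⟦ σ x y ⟧ * f y

  -- The bound for a nonzero eigenvalue

  eigenvalue-bound : Connected → ∀ {D} → IsDiameter D → ∀ {p} → 1# < p →
    ∀ {μ} → IsEigenvalue p μ → ¬ μ ≈ 0# → (fromℕ (suc D) ^ (p - 1#) * fromℕ vol) ⁻¹ ≤ μ
  eigenvalue-bound connected {D} diameter {p} 1<p {μ} (f , f≢0 , eigen) μ≉0 =
    bound steep-edge
    where
    support : ∃ λ x → ¬ f x ≈ 0#
    support = em⇒dne em λ none → f≢0 λ x → em⇒dne em λ fx≉0 → none (x , fx≉0)

    maximum : ∀ {m} → Fin m → (g : Fin m → Carrier) → ∃ λ i → ∀ j → g j ≤ g i
    maximum {suc m} _ g = argmax g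

    x₀ : Fin n
    x₀ = proj₁ (maximum (proj₁ support) (abs ∘ f))
    M c δ : Carrier
    M = abs (f x₀)
    c = fromℕ (suc D)
    δ = c ⁻¹ * M

    ∣f∣≤M : ∀ x → abs (f x) ≤ M
    ∣f∣≤M = proj₂ (maximum (proj₁ support) (abs ∘ f))
    0<M : 0# < M
    0<M = 0<-≤-trans (abs-pos (proj₂ support)) (∣f∣≤M (proj₁ support))
    0<c : 0# < c
    0<c = 0<fromℕ-suc D
    0<δ : 0# < δ
    0<δ = *-pos (⁻¹-pos 0<c) 0<M
    M≈cδ : M ≈ c * δ
    M≈cδ = begin-equality
      M               ≈⟨ *-identityˡ M ⟨
      1# * M          ≈⟨ *-congʳ (⁻¹-inverseʳ (<⇒≉0 0<c)) ⟨
      c * c ⁻¹ * M    ≈⟨ *-assoc c _ M ⟩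
      c * δ           ∎

    SteepEdge : Set ℓ
    SteepEdge = ∃₂ λ x y → x ~ y × δ ≤ abs (f x - ⟦ σ x y ⟧ * f y)

    steep-edge : SteepEdge
    steep-edge = em⇒dne em λ none → flat-absurd λ x~y → ≰⇒> λ steep → none (_ , _ , x~y , steep)
      where
      flat-absurd : ¬ (∀ {x y} → x ~ y → abs (f x - ⟦ σ x y ⟧ * f y) < δ)
      flat-absurd flat = not-flat 1<p eigen μ≉0 0<δ δ≤∣f∣ x₀ flat
        where
        δ≤∣f∣ : ∀ x → δ ≤ abs (f x)
        -- The choice of D + 1 in the definition of δ is used here: out of M = (D + 1) δ a flat walk
        -- can lose at most D δ, so one δ is left at its end.
        δ≤∣f∣ x = let (k , k≤D , walk) = walk-within-diameter connected diameter x₀ x in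
          +-cancelʳ-≤ (fromℕ D * δ) (begin
            δ + fromℕ D * δ             ≈⟨ solve 2 (λ δ D → δ :+ D :* δ := (:1 :+ D) :* δ) refl δ (fromℕ D) ⟩
            c * δ                       ≈⟨ M≈cδ ⟨
            M                           ≤⟨ flat-walk flat walk ⟩
            abs (f x) + fromℕ k * δ     ≤⟨ +-mono-≤ ≤-refl (*-monoˡ-≤ (proj₁ 0<δ) (fromℕ-mono-≤ k≤D)) ⟩
            abs (f x) + fromℕ D * δ     ∎)

    bound : SteepEdge → (c ^ (p - 1#) * fromℕ vol) ⁻¹ ≤ μ
    -- Since φ(M) is a multiple of φ(δ), the latter cancels, and with it the last trace of the
    -- eigenfunction.
    bound (x , y , x~y , steep) = 1≤x*y⇒y⁻¹≤x (proj₁ steep-bound) (*-cancelʳ-≤ (φ-pos 1<p 0<δ) (begin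
      1# * φ p δ                                   ≈⟨ *-identityˡ _ ⟩
      φ p δ                                        ≤⟨ proj₂ steep-bound ⟩
      μ * (fromℕ vol * φ p M)                      ≈⟨ *-congˡ (*-congˡ (φ-scale 1<p (1≤fromℕ-suc D) 0<δ M≈cδ)) ⟩
      μ * (fromℕ vol * (c ^ (p - 1#) * φ p δ))
        ≈⟨ solve 4 (λ m v k d → m :* (v :* (k :* d)) := m :* (k :* v) :* d) refl μ (fromℕ vol) (c ^ (p - 1#)) (φ p δ) ⟩
      μ * (c ^ (p - 1#) * fromℕ vol) * φ p δ       ∎))
      where
      steep-bound : 0# ≤ μ × φ p δ ≤ μ * (fromℕ vol * φ p M)
      steep-bound = steep-edge-bound 1<p eigen 0<δ ∣f∣≤M x~y steep

theorem4p2 : ∀ {ℓ} (em : ExcludedMiddle ℓ) (ℝ : CompleteOrderedField ℓ) →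
    let open CompleteOrderedField ℝ
        open RealOperations em ℝ in
    ∀ {n : ℕ} (G : SignedGraph n) →
    let open SignedGraph G
        open PLaplacian em ℝ G in
    Connected →
    ∀ (D : ℕ) → IsDiameter D →
    ∀ (p : Carrier) → 1# < p →
    ∀ (lam : Carrier) → IsFirstNonzeroEigenvalue p lam →
    (fromℕ (suc D) ^ (p - 1#) * fromℕ vol) ⁻¹ ≤ lam
theorem4p2 em ℝ G connected D diameter p 1<p lam ((eigenvalue , lam≉0) , _) =
  eigenvalue-bound connected diameter 1<p eigenvalue lam≉0
  where open Eigenfunctions em ℝ G
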